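{- Let $X\subseteq\mathbb{Z}^2\setminus\{O\}$ be an arbitrary non-empty step set. Then $\mathcal{A}_X$ is a group if and only if $O$ belongs to the relative interior of $\operatorname{Conv}(X)$.
   Context: Write $O=(0,0)$. A step set is any (finite or infinite) subset $X$ of $\mathbb{Z}^2\setminus\{O\}$. $\mathcal{A}_X$ is the additive submonoid of $\mathbb{Z}^2$ generated by $X$ (with identity $O$). $\operatorname{Conv}(X)$ is the convex hull of $X$ in $\mathbb{R}^2$. The relative interior of a subset $U\subseteq\mathbb{R}^2$ is its interior relative to the smallest affine subspace of $\mathbb{R}^2$ containing $U$. -}

module Defs where

open import Algebra.Bundles using (RawMonoid; Monoid)
open import Algebra.Definitions.RawMonoid using (sum)
open import Algebra.Structures using (IsGroup)
open import Data.Fin.Base using (Fin)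
open import Data.Integer.Base as ℤ using (ℤ; 0ℤ)
import Data.Integer.Properties as ℤ
open import Data.Nat.Base as ℕ using (ℕ)
import Data.Nat.Properties as ℕ
open import Data.Product.Base using (Σ; ∃; ∃-syntax; _×_; _,_; proj₁; proj₂)
open import Data.Rational.Base as ℚ using (ℚ; 0ℚ; 1ℚ)
import Data.Rational.Properties as ℚ
open import Data.Rational.Solver using (module +-*-Solver)
open import Function.Base using (_on_)
open import Level using (0ℓ; _⊔_; suc)
open import Relation.Binary.PropositionalEquality
  using (_≡_; refl; sym; trans; cong; cong₂; subst)
open import Relation.Unary using (Pred; _∈_; _⊆_)

private
  module _ where
    open import Data.Rational.Base using (_+_; _-_; _*_; -_)
    open +-*-Solver

    rearrange-+ : ∀ a b c d → (a + b) - (c + d) ≡ (a - c) + (b - d)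
    rearrange-+ = solve 4 (λ a b c d → (a :+ b) :- (c :+ d) := (a :- c) :+ (b :- d)) refl

    rearrange-* : ∀ a b c d → a * b - c * d ≡ a * (b - d) + d * (a - c)
    rearrange-* = solve 4
      (λ a b c d → a :* b :- c :* d := a :* (b :- d) :+ d :* (a :- c)) refl

    rearrange-neg : ∀ a b → - (a - b) ≡ - a - - b
    rearrange-neg = solve 2 (λ a b → :- (a :- b) := :- a :- :- b) refl

    add-difference : ∀ a b → a ≡ b + (a - b)
    add-difference = solve 2 (λ a b → a := b :+ (a :- b)) refl

    double : ∀ e → e + e ≡ (1ℚ + 1ℚ) * e
    double = solve 1 (λ e → e :+ e := (con 1ℚ :+ con 1ℚ) :* e) refl

-- ℝ is the type of Cauchy sequences of rationals, considered up to _≃_.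

IsCauchy : (ℕ → ℚ) → Set
IsCauchy s = ∀ ε → 0ℚ ℚ.< ε →
  ∃[ N ] ∀ m n → N ℕ.≤ m → N ℕ.≤ n → ℚ.∣ s m ℚ.- s n ∣ ℚ.< ε

-- Abstract, so that the type checker never unfolds the Cauchy proofs inside reals.
abstract
  const-cauchy : ∀ q → IsCauchy (λ _ → q)
  const-cauchy q ε 0<ε = 0 , λ _ _ _ _ →
    subst (λ z → ℚ.∣ z ∣ ℚ.< ε) (sym (ℚ.+-inverseʳ q)) 0<ε

  scale-down : ∀ {a ε} → 0ℚ ℚ.< a → 0ℚ ℚ.< ε → ∃[ δ ] 0ℚ ℚ.< δ × a ℚ.* δ ≡ ε
  scale-down {a} {ε} 0<a 0<ε = 1/a ℚ.* ε , 0<δ , eq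
    where
    instance
      a-pos : ℚ.Positive a
      a-pos = ℚ.positive 0<a
      a-nonZero : ℚ.NonZero a
      a-nonZero = ℚ.pos⇒nonZero a
    1/a : ℚ
    1/a = ℚ.1/ a
    0<δ : 0ℚ ℚ.< 1/a ℚ.* ε
    0<δ = ℚ.positive⁻¹ (1/a ℚ.* ε)
      {{ℚ.pos*pos⇒pos 1/a {{ℚ.1/pos⇒pos a}} ε {{ℚ.positive 0<ε}}}}
    eq : a ℚ.* (1/a ℚ.* ε) ≡ ε
    eq = trans (sym (ℚ.*-assoc a 1/a ε))
      (trans (cong (ℚ._* ε) (ℚ.*-inverseʳ a)) (ℚ.*-identityˡ ε))

  halve : ∀ {ε} → 0ℚ ℚ.< ε → ∃[ δ ] 0ℚ ℚ.< δ × δ ℚ.+ δ ≡ ε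
  halve 0<ε = let δ , 0<δ , eq = scale-down (ℚ.positive⁻¹ (1ℚ ℚ.+ 1ℚ)) 0<ε in
    δ , 0<δ , trans (double δ) eq

  +-cauchy : ∀ s t → IsCauchy s → IsCauchy t → IsCauchy (λ n → s n ℚ.+ t n)
  +-cauchy s t cs ct ε 0<ε =
    let δ , 0<δ , eq = halve 0<ε
        M , S = cs δ 0<δ
        N , T = ct δ 0<δ
    in M ℕ.⊔ N , λ m n m≥ n≥ → close δ eq (s m) (t m) (s n) (t n)
         (S m n (ℕ.m⊔n≤o⇒m≤o M N m≥) (ℕ.m⊔n≤o⇒m≤o M N n≥))
         (T m n (ℕ.m⊔n≤o⇒n≤o M N m≥) (ℕ.m⊔n≤o⇒n≤o M N n≥))
    where
    open ℚ.≤-Reasoning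
    close : ∀ δ → δ ℚ.+ δ ≡ ε → ∀ x y z w →
            ℚ.∣ x ℚ.- z ∣ ℚ.< δ → ℚ.∣ y ℚ.- w ∣ ℚ.< δ →
            ℚ.∣ (x ℚ.+ y) ℚ.- (z ℚ.+ w) ∣ ℚ.< ε
    close δ eq x y z w p q = begin-strict
      ℚ.∣ (x ℚ.+ y) ℚ.- (z ℚ.+ w) ∣       ≡⟨ cong ℚ.∣_∣ (rearrange-+ x y z w) ⟩
      ℚ.∣ (x ℚ.- z) ℚ.+ (y ℚ.- w) ∣       ≤⟨ ℚ.∣p+q∣≤∣p∣+∣q∣ (x ℚ.- z) (y ℚ.- w) ⟩
      ℚ.∣ x ℚ.- z ∣ ℚ.+ ℚ.∣ y ℚ.- w ∣     <⟨ ℚ.+-mono-< p q ⟩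
      δ ℚ.+ δ                             ≡⟨ eq ⟩
      ε                                   ∎

  neg-cauchy : ∀ s → IsCauchy s → IsCauchy (λ n → ℚ.- s n)
  neg-cauchy s cs ε 0<ε =
    let N , S = cs ε 0<ε
    in N , λ m n m≥ n≥ → subst (ℚ._< ε) (eq (s m) (s n)) (S m n m≥ n≥)
    where
    eq : ∀ x y → ℚ.∣ x ℚ.- y ∣ ≡ ℚ.∣ ℚ.- x ℚ.- ℚ.- y ∣
    eq x y = trans (sym (ℚ.∣-p∣≡∣p∣ (x ℚ.- y))) (cong ℚ.∣_∣ (rearrange-neg x y))

  eventually-bounded : ∀ s → IsCauchy s →
    ∃[ b ] 0ℚ ℚ.< b × ∃[ N ] ∀ n → N ℕ.≤ n → ℚ.∣ s n ∣ ℚ.≤ b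
  eventually-bounded s cs =
    let N , S = cs 1ℚ (ℚ.positive⁻¹ 1ℚ)
    in ℚ.∣ s N ∣ ℚ.+ 1ℚ
     , ℚ.+-mono-≤-< (ℚ.0≤∣p∣ (s N)) (ℚ.positive⁻¹ 1ℚ)
     , N , λ n n≥ → bound (s n) (s N) (S n N n≥ ℕ.≤-refl)
    where
    open ℚ.≤-Reasoning
    bound : ∀ x y → ℚ.∣ x ℚ.- y ∣ ℚ.< 1ℚ → ℚ.∣ x ∣ ℚ.≤ ℚ.∣ y ∣ ℚ.+ 1ℚ
    bound x y p = begin
      ℚ.∣ x ∣                     ≡⟨ cong ℚ.∣_∣ (add-difference x y) ⟩
      ℚ.∣ y ℚ.+ (x ℚ.- y) ∣       ≤⟨ ℚ.∣p+q∣≤∣p∣+∣q∣ y (x ℚ.- y) ⟩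
      ℚ.∣ y ∣ ℚ.+ ℚ.∣ x ℚ.- y ∣   ≤⟨ ℚ.+-monoʳ-≤ ℚ.∣ y ∣ (ℚ.<⇒≤ p) ⟩
      ℚ.∣ y ∣ ℚ.+ 1ℚ              ∎

  product-bound : ∀ {a δ} → 0ℚ ℚ.< a → ∀ p q → ℚ.∣ p ∣ ℚ.≤ a → ℚ.∣ q ∣ ℚ.< δ →
                  ℚ.∣ p ℚ.* q ∣ ℚ.< a ℚ.* δ
  product-bound {a} {δ} 0<a p q p≤a q<δ = begin-strict
    ℚ.∣ p ℚ.* q ∣         ≡⟨ ℚ.∣p*q∣≡∣p∣*∣q∣ p q ⟩
    ℚ.∣ p ∣ ℚ.* ℚ.∣ q ∣   ≤⟨ ℚ.*-monoʳ-≤-nonNeg ℚ.∣ q ∣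
                               {{ℚ.nonNegative (ℚ.0≤∣p∣ q)}} p≤a ⟩
    a ℚ.* ℚ.∣ q ∣         <⟨ ℚ.*-monoʳ-<-pos a {{ℚ.positive 0<a}} q<δ ⟩
    a ℚ.* δ               ∎
    where open ℚ.≤-Reasoning

  *-cauchy : ∀ s t → IsCauchy s → IsCauchy t → IsCauchy (λ n → s n ℚ.* t n)
  *-cauchy s t cs ct ε 0<ε =
    let b , 0<b , K , s≤b = eventually-bounded s cs
        c , 0<c , L , t≤c = eventually-bounded t ct
        δ , 0<δ , eq = scale-down (ℚ.+-mono-< 0<b 0<c) 0<ε
        M , S = cs δ 0<δ
        N , T = ct δ 0<δ
    in (K ℕ.⊔ L) ℕ.⊔ (M ℕ.⊔ N) , λ m n m≥ n≥ →
      let K⊔L≤m = ℕ.m⊔n≤o⇒m≤o (K ℕ.⊔ L) (M ℕ.⊔ N) m≥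
          K⊔L≤n = ℕ.m⊔n≤o⇒m≤o (K ℕ.⊔ L) (M ℕ.⊔ N) n≥
          M⊔N≤m = ℕ.m⊔n≤o⇒n≤o (K ℕ.⊔ L) (M ℕ.⊔ N) m≥
          M⊔N≤n = ℕ.m⊔n≤o⇒n≤o (K ℕ.⊔ L) (M ℕ.⊔ N) n≥
      in close b c δ eq (s m) (t m) (s n) (t n)
           (product-bound 0<b (s m) (t m ℚ.- t n) (s≤b m (ℕ.m⊔n≤o⇒m≤o K L K⊔L≤m))
             (T m n (ℕ.m⊔n≤o⇒n≤o M N M⊔N≤m) (ℕ.m⊔n≤o⇒n≤o M N M⊔N≤n)))
           (product-bound 0<c (t n) (s m ℚ.- s n) (t≤c n (ℕ.m⊔n≤o⇒n≤o K L K⊔L≤n))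
             (S m n (ℕ.m⊔n≤o⇒m≤o M N M⊔N≤m) (ℕ.m⊔n≤o⇒m≤o M N M⊔N≤n)))
    where
    open ℚ.≤-Reasoning
    close : ∀ b c δ → (b ℚ.+ c) ℚ.* δ ≡ ε → ∀ x y z w →
            ℚ.∣ x ℚ.* (y ℚ.- w) ∣ ℚ.< b ℚ.* δ → ℚ.∣ w ℚ.* (x ℚ.- z) ∣ ℚ.< c ℚ.* δ →
            ℚ.∣ x ℚ.* y ℚ.- z ℚ.* w ∣ ℚ.< ε
    close b c δ eq x y z w p q = begin-strict
      ℚ.∣ x ℚ.* y ℚ.- z ℚ.* w ∣
        ≡⟨ cong ℚ.∣_∣ (rearrange-* x y z w) ⟩
      ℚ.∣ x ℚ.* (y ℚ.- w) ℚ.+ w ℚ.* (x ℚ.- z) ∣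
        ≤⟨ ℚ.∣p+q∣≤∣p∣+∣q∣ (x ℚ.* (y ℚ.- w)) (w ℚ.* (x ℚ.- z)) ⟩
      ℚ.∣ x ℚ.* (y ℚ.- w) ∣ ℚ.+ ℚ.∣ w ℚ.* (x ℚ.- z) ∣
        <⟨ ℚ.+-mono-< p q ⟩
      b ℚ.* δ ℚ.+ c ℚ.* δ
        ≡⟨ ℚ.*-distribʳ-+ δ b c ⟨
      (b ℚ.+ c) ℚ.* δ
        ≡⟨ eq ⟩
      ε ∎

record ℝ : Set where
  constructor mkℝ
  field
    seq    : ℕ → ℚ
    cauchy : IsCauchy seq
open ℝ public

infix  4 _≃_ _<_ _≤_
infixl 6 _+_ _-_
infixl 7 _*_
infix  8 -_

_≃_ : ℝ → ℝ → Set
x ≃ y = ∀ ε → 0ℚ ℚ.< ε → ∃[ N ] ∀ n → N ℕ.≤ n → ℚ.∣ seq x n ℚ.- seq y n ∣ ℚ.< ε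

_<_ : ℝ → ℝ → Set
x < y = ∃[ ε ] 0ℚ ℚ.< ε × ∃[ N ] ∀ n → N ℕ.≤ n → seq x n ℚ.+ ε ℚ.< seq y n

_≤_ : ℝ → ℝ → Set
x ≤ y = ∀ ε → 0ℚ ℚ.< ε → ∃[ N ] ∀ n → N ℕ.≤ n → seq x n ℚ.< seq y n ℚ.+ ε

fromℚ : ℚ → ℝ
fromℚ q = mkℝ (λ _ → q) (const-cauchy q)

fromℤ : ℤ → ℝ
fromℤ i = fromℚ (i ℚ./ 1)

0ℝ 1ℝ : ℝ
0ℝ = fromℚ 0ℚ
1ℝ = fromℚ 1ℚ

_+_ _*_ : ℝ → ℝ → ℝ
x + y = mkℝ (λ n → seq x n ℚ.+ seq y n) (+-cauchy (seq x) (seq y) (cauchy x) (cauchy y))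
x * y = mkℝ (λ n → seq x n ℚ.* seq y n) (*-cauchy (seq x) (seq y) (cauchy x) (cauchy y))

-_ : ℝ → ℝ
- x = mkℝ (λ n → ℚ.- seq x n) (neg-cauchy (seq x) (cauchy x))

_-_ : ℝ → ℝ → ℝ
x - y = x + (- y)

+-rawMonoid : RawMonoid 0ℓ 0ℓ
+-rawMonoid = record { Carrier = ℝ ; _≈_ = _≃_ ; _∙_ = _+_ ; ε = 0ℝ }

ℝ² : Set
ℝ² = ℝ × ℝ

infix  4 _≃²_
infixl 6 _+²_ _-²_
infixl 7 _·_

_≃²_ : ℝ² → ℝ² → Set
(x , y) ≃² (x′ , y′) = x ≃ x′ × y ≃ y′

_+²_ _-²_ : ℝ² → ℝ² → ℝ²
(x , y) +² (x′ , y′) = x + x′ , y + y′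
(x , y) -² (x′ , y′) = x - x′ , y - y′

_·_ : ℝ → ℝ² → ℝ²
t · (x , y) = t * x , t * y

O : ℝ²
O = 0ℝ , 0ℝ

+²-rawMonoid : RawMonoid 0ℓ 0ℓ
+²-rawMonoid = record { Carrier = ℝ² ; _≈_ = _≃²_ ; _∙_ = _+²_ ; ε = O }

∥_∥² : ℝ² → ℝ
∥ x , y ∥² = x * x + y * y

Conv : Pred ℝ² 0ℓ → Pred ℝ² 0ℓ
Conv U p = ∃[ n ] Σ (Fin n → ℝ) λ w → Σ (Fin n → ℝ²) λ u →
  (∀ i → 0ℝ ≤ w i) ×
  sum +-rawMonoid w ≃ 1ℝ ×
  (∀ i → u i ∈ U) ×
  p ≃² sum +²-rawMonoid (λ i → w i · u i)

-- The empty set counts as affine; this does not affect which points lie in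
-- an affine subspace containing a non-empty set.
record IsAffine (V : Pred ℝ² 0ℓ) : Set where
  field
    resp  : ∀ {p q} → p ≃² q → p ∈ V → q ∈ V
    lines : ∀ {p q} → p ∈ V → q ∈ V → ∀ t → (1ℝ - t) · p +² t · q ∈ V

-- The smallest affine subspace containing U, as the intersection of all of them.
Aff : Pred ℝ² 0ℓ → Pred ℝ² (suc 0ℓ)
Aff U p = ∀ V → IsAffine V → U ⊆ V → p ∈ V

RelInt : Pred ℝ² 0ℓ → Pred ℝ² (suc 0ℓ)
RelInt U p = p ∈ Aff U ×
  ∃[ ε ] 0ℝ < ε × (∀ q → q ∈ Aff U → ∥ q -² p ∥² < ε * ε → q ∈ U)

ℤ² : Set
ℤ² = ℤ × ℤ

infixl 6 _+ᶻ_

_+ᶻ_ : ℤ² → ℤ² → ℤ²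
(i , j) +ᶻ (k , l) = i ℤ.+ k , j ℤ.+ l

Oᶻ : ℤ²
Oᶻ = 0ℤ , 0ℤ

-- The image of X under the inclusion of ℤ² into ℝ².
inℝ² : Pred ℤ² 0ℓ → Pred ℝ² 0ℓ
inℝ² X p = Σ ℤ² λ (i , j) → (i , j) ∈ X × p ≃² (fromℤ i , fromℤ j)

data ⟨_⟩ (X : Pred ℤ² 0ℓ) : Pred ℤ² 0ℓ where
  gen  : ∀ {a} → a ∈ X → a ∈ ⟨ X ⟩
  zero : Oᶻ ∈ ⟨ X ⟩
  add  : ∀ {a b} → a ∈ ⟨ X ⟩ → b ∈ ⟨ X ⟩ → a +ᶻ b ∈ ⟨ X ⟩

𝒜 : Pred ℤ² 0ℓ → Monoid 0ℓ 0ℓ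
𝒜 X = record
  { Carrier  = ∃ ⟨ X ⟩
  ; _≈_      = _≡_ on proj₁
  ; _∙_      = λ (a , a∈) (b , b∈) → a +ᶻ b , add a∈ b∈
  ; ε        = Oᶻ , zero
  ; isMonoid = record
    { isSemigroup = record
      { isMagma = record
        { isEquivalence = record { refl = refl ; sym = sym ; trans = trans }
        ; ∙-cong        = cong₂ _+ᶻ_
        }
      ; assoc = λ ((i , j) , _) ((k , l) , _) ((m , n) , _) →
          cong₂ _,_ (ℤ.+-assoc i k m) (ℤ.+-assoc j l n)
      }
    ; identity = (λ ((i , j) , _) → cong₂ _,_ (ℤ.+-identityˡ i) (ℤ.+-identityˡ j))
               , (λ ((i , j) , _) → cong₂ _,_ (ℤ.+-identityʳ i) (ℤ.+-identityʳ j))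
    }
  }

MonoidIsGroup : ∀ {c ℓ} → Monoid c ℓ → Set (c ⊔ ℓ)
MonoidIsGroup M = ∃[ inv ] IsGroup _≈_ _∙_ ε inv
  where open Monoid M

{-# OPTIONS --safe #-}
-- If O is in the relative interior, then -t a lies in Conv X for each a in X and
-- some rational t > 0. If no positive multiple of -a were a sum of elements of X,
-- Farkas' lemma over ℤ would give an integer functional contradicting this real
-- relation; so -a is in 𝒜 X, being (k - 1) a + k (-a). Conversely, choose u, v in X
-- spanning the same subspace as X. The inverse of u + v is a sum of k elements of X,
-- so spreading the weight 1 - s - t evenly over these k elements, u and v turns
-- s u + t v into a convex combination as soon as |s|, |t| ≤ 1 / (k + 2).
module Submission where

open import Defs
open import Axiom.ExcludedMiddle using (ExcludedMiddle)
open import Function.Bundles using (_⇔_; mk⇔)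
open import Level using (0ℓ)
open import Relation.Unary using (Pred; _∈_; _∉_; Satisfiable)
open import Algebra.Bundles using (Monoid)
open import Algebra.Definitions.RawMonoid using (sum)
open import Algebra.Structures using (IsGroup)
open import Data.Empty using (⊥-elim)
open import Data.Fin.Base using (Fin; zero; suc)
open import Data.Integer.Base as ℤ using (ℤ; 0ℤ; 1ℤ; +_; -[1+_]; +[1+_]; -<+; +≤+)
import Data.Integer.Properties as ℤ
import Data.Integer.Solver as ℤ-Solver
open import Data.Nat.Base as ℕ using (ℕ; z≤n)
import Data.Nat.Properties as ℕ
open import Data.Product.Base using (Σ; ∃; ∃-syntax; _×_; _,_; proj₁; proj₂)
open import Data.Rational.Base as ℚ using (ℚ; 0ℚ; 1ℚ)
import Data.Rational.Properties as ℚ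
open import Data.Rational.Solver using (module +-*-Solver)
open import Data.Rational.Unnormalised.Base as ℚᵘ using (ℚᵘ; mkℚᵘ)
import Data.Rational.Unnormalised.Properties as ℚᵘ
open import Data.Sum.Base using (_⊎_; inj₁; inj₂)
open import Data.Vec.Functional using (_∷_)
open import Relation.Binary.Bundles using (Setoid)
open import Relation.Binary.PropositionalEquality
  using (_≡_; _≢_; refl; sym; trans; cong; cong₂; subst; subst₂)
open import Relation.Nullary using (yes; no)
open import Relation.Nullary.Decidable using (decidable-stable)

-- The integer lattice

-- The obstacle in one direction is that the weights of a convex combination are real, so
-- denominators cannot be cleared to turn it into a sum of elements of `X`. The weights are
-- therefore never made integral: an integer functional is applied to the combination, and the sign
-- of its value, a rational constant, decides the matter. In the other direction `RelInt` asks about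
-- every real point of the affine hull. Coordinates with respect to `u` and `v` are given by
-- explicit rational functionals, and their coefficients determine the radius of the ball. Inverting
-- the single element `u + v`, rather than `u` and `v` separately, yields one relation in which
-- every summand has a positive coefficient, so the same weight can be laid on all `k + 2` summands;
-- this leaves room for small coefficients of either sign at `u` and `v`. Excluded middle enters
-- only in the choice of `v`: for an arbitrary predicate `X` one has to know whether some element
-- lies off the line through `u`.

infixr 7 _·ᶻ_

_·ᶻ_ : ℤ → ℤ² → ℤ²
k ·ᶻ (i , j) = k ℤ.* i , k ℤ.* j

-ᶻ_ : ℤ² → ℤ²
-ᶻ (i , j) = ℤ.- i , ℤ.- j

dot : ℤ² → ℤ² → ℤ
dot (a , b) (i , j) = a ℤ.* i ℤ.+ b ℤ.* j

0<i*j : ∀ {i j} → 0ℤ ℤ.< i → 0ℤ ℤ.< j → 0ℤ ℤ.< i ℤ.* j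
0<i*j {i} {j} 0<i 0<j = subst (ℤ._< i ℤ.* j) (ℤ.*-zeroʳ i)
  (ℤ.*-monoˡ-<-pos i {{ℤ.positive 0<i}} 0<j)

0≤i*j : ∀ {i j} → 0ℤ ℤ.≤ i → 0ℤ ℤ.≤ j → 0ℤ ℤ.≤ i ℤ.* j
0≤i*j {i} {j} 0≤i 0≤j = subst (ℤ._≤ i ℤ.* j) (ℤ.*-zeroʳ i)
  (ℤ.*-monoˡ-≤-nonNeg i {{ℤ.nonNegative 0≤i}} 0≤j)

0≤i*i : ∀ i → 0ℤ ℤ.≤ i ℤ.* i
0≤i*i (+ n)    = 0≤i*j {+ n} {+ n} (+≤+ z≤n) (+≤+ z≤n)
0≤i*i -[1+ n ] = +≤+ z≤n

0<dot : ∀ {a} → a ≢ Oᶻ → 0ℤ ℤ.< dot a a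
0<dot {+ 0      , + 0}      a≢O = ⊥-elim (a≢O refl)
0<dot {+ 0      , +[1+ n ]} a≢O = ℤ.+<+ (ℕ.s≤s z≤n)
0<dot {+ 0      , -[1+ n ]} a≢O = ℤ.+<+ (ℕ.s≤s z≤n)
0<dot {+[1+ m ] , j}        a≢O = ℤ.+-mono-<-≤ (ℤ.+<+ (ℕ.s≤s z≤n)) (0≤i*i j)
0<dot { -[1+ m ] , j}       a≢O = ℤ.+-mono-<-≤ (ℤ.+<+ (ℕ.s≤s z≤n)) (0≤i*i j)

module _ where
  open ℤ-Solver.+-*-Solver

  dot-neg : ∀ f a → dot f (-ᶻ a) ≡ ℤ.- dot f a
  dot-neg (f₁ , f₂) (i , j) = solve 4
    (λ f₁ f₂ i j → f₁ :* :- i :+ f₂ :* :- j := :- (f₁ :* i :+ f₂ :* j)) refl f₁ f₂ i j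

-- Farkas' lemma over the integers, and inverses in the generated monoid

module _ {X : Pred ℤ² 0ℓ} where
  open ℤ-Solver.+-*-Solver

  scale∈ : ∀ {k a} → 0ℤ ℤ.≤ k → a ∈ ⟨ X ⟩ → k ·ᶻ a ∈ ⟨ X ⟩
  scale∈ {+ ℕ.zero}  {a} _ a∈ = zero
  scale∈ {+ ℕ.suc n} {a} _ a∈ = subst (_∈ ⟨ X ⟩)
    (cong₂ _,_ (sym (ℤ.suc-* (+ n) (proj₁ a))) (sym (ℤ.suc-* (+ n) (proj₂ a))))
    (add a∈ (scale∈ {+ n} {a} (+≤+ z≤n) a∈))

  -- The first case records membership in `⟨ X ⟩` instead of coefficients over `y`. Projected
  -- vectors, which are sums of elements of `X`, can then serve as generators in the recursion. The
  -- factor `k` absorbs denominators.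
  Alternative : ∀ {n} → (Fin n → ℤ²) → ℤ² → Set
  Alternative y b =
    (∃[ k ] 0ℤ ℤ.< k × k ·ᶻ b ∈ ⟨ X ⟩) ⊎
    (∃[ f ] (∀ i → 0ℤ ℤ.≤ dot f (y i)) × dot f b ℤ.< 0ℤ)

  -- A homogeneous form of Farkas' lemma, by elimination: when the functional f
  -- found for the other generators is negative at the first one, everything is
  -- projected along that generator onto the kernel of f.
  farkas : ∀ n (y : Fin n → ℤ²) → (∀ i → y i ∈ ⟨ X ⟩) → ∀ b → Alternative y b
  farkas ℕ.zero y y∈ (+ 0      , + 0)      = inj₁ (1ℤ , ℤ.positive⁻¹ 1ℤ , zero)
  farkas ℕ.zero y y∈ (+ 0      , +[1+ _ ]) = inj₂ ((0ℤ , ℤ.- 1ℤ) , (λ ()) , -<+)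
  farkas ℕ.zero y y∈ (+ 0      , -[1+ _ ]) = inj₂ ((0ℤ , 1ℤ) , (λ ()) , -<+)
  farkas ℕ.zero y y∈ (+[1+ _ ] , _)        = inj₂ ((ℤ.- 1ℤ , 0ℤ) , (λ ()) , -<+)
  farkas ℕ.zero y y∈ (-[1+ _ ] , _)        = inj₂ ((1ℤ , 0ℤ) , (λ ()) , -<+)
  farkas (ℕ.suc n) y y∈ b with farkas n (λ i → y (suc i)) (λ i → y∈ (suc i)) b
  ... | inj₁ kb∈ = inj₁ kb∈
  ... | inj₂ (f , f≥0 , fb<0) with 0ℤ ℤ.≤? dot f (y zero)
  ...   | yes 0≤fy₀ = inj₂ (f , (λ { zero → 0≤fy₀ ; (suc i) → f≥0 i }) , fb<0)
  ...   | no  0≰fy₀ = lift (farkas n (λ i → project (y (suc i))) project∈ (project b))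
    where
    c : ℤ
    c = ℤ.- dot f (y zero)

    0<c : 0ℤ ℤ.< c
    0<c = ℤ.neg-mono-< (ℤ.≰⇒> 0≰fy₀)

    -- Scaling by `c` replaces the division by `dot f (y zero)`. Both coefficients are nonnegative
    -- at the remaining generators, so their projections stay in `⟨ X ⟩`.
    project : ℤ² → ℤ²
    project a = (c ·ᶻ a) +ᶻ (dot f a ·ᶻ y zero)

    project∈ : ∀ i → project (y (suc i)) ∈ ⟨ X ⟩
    project∈ i = add (scale∈ (ℤ.<⇒≤ 0<c) (y∈ (suc i))) (scale∈ (f≥0 i) (y∈ zero))

    -- The transpose of `project`. Since `project` kills `y zero`, every functional pulled back this
    -- way vanishes there.
    pullback : ℤ² → ℤ²
    pullback g = (c ·ᶻ g) +ᶻ (dot g (y zero) ·ᶻ f)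

    dot-pullback : ∀ g a → dot (pullback g) a ≡ dot g (project a)
    dot-pullback g a = solve 9
      (λ c f₁ f₂ g₁ g₂ a₁ a₂ z₁ z₂ →
        (c :* g₁ :+ (g₁ :* z₁ :+ g₂ :* z₂) :* f₁) :* a₁ :+
        (c :* g₂ :+ (g₁ :* z₁ :+ g₂ :* z₂) :* f₂) :* a₂ :=
        g₁ :* (c :* a₁ :+ (f₁ :* a₁ :+ f₂ :* a₂) :* z₁) :+
        g₂ :* (c :* a₂ :+ (f₁ :* a₁ :+ f₂ :* a₂) :* z₂))
      refl c (proj₁ f) (proj₂ f) (proj₁ g) (proj₂ g) (proj₁ a) (proj₂ a)
      (proj₁ (y zero)) (proj₂ (y zero))

    dot-project-y₀ : ∀ g → dot g (project (y zero)) ≡ 0ℤ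
    dot-project-y₀ g = solve 5
      (λ d g₁ g₂ z₁ z₂ →
        g₁ :* (:- d :* z₁ :+ d :* z₁) :+ g₂ :* (:- d :* z₂ :+ d :* z₂) := con 0ℤ)
      refl (dot f (y zero)) (proj₁ g) (proj₂ g) (proj₁ (y zero)) (proj₂ (y zero))

    unproject : ∀ k d e b₁ z₁ →
      k ℤ.* (e ℤ.* b₁ ℤ.+ d ℤ.* z₁) ℤ.+ k ℤ.* (ℤ.- d) ℤ.* z₁ ≡ k ℤ.* e ℤ.* b₁
    unproject = solve 5
      (λ k d e b₁ z₁ →
        k :* (e :* b₁ :+ d :* z₁) :+ k :* (:- d) :* z₁ := k :* e :* b₁)
      refl

    lift : Alternative (λ i → project (y (suc i))) (project b) → Alternative y b
    -- `k` times `project b` is `k c b` plus `k (dot f b)` times `y zero`. The second term is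
    -- cancelled by adding `y zero` with weight `k (- dot f b)`, which is nonnegative because
    -- `dot f b` is negative.
    lift (inj₁ (k , 0<k , k∈)) = inj₁ (k ℤ.* c , 0<i*j 0<k 0<c , subst (_∈ ⟨ X ⟩)
      (cong₂ _,_ (unproject k (dot f b) c (proj₁ b) (proj₁ (y zero)))
                 (unproject k (dot f b) c (proj₂ b) (proj₂ (y zero))))
      (add k∈ (scale∈ (0≤i*j (ℤ.<⇒≤ 0<k) (ℤ.<⇒≤ (ℤ.neg-mono-< fb<0))) (y∈ zero))))
    lift (inj₂ (g , g≥0 , gb<0)) = inj₂ (pullback g
      , (λ { zero    → ℤ.≤-reflexive (sym (trans (dot-pullback g (y zero)) (dot-project-y₀ g)))
           ; (suc i) → subst (0ℤ ℤ.≤_) (sym (dot-pullback g (y (suc i)))) (g≥0 i) })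
      , subst (ℤ._< 0ℤ) (sym (dot-pullback g b)) gb<0)

  neg∈ : ∀ {k a} → 0ℤ ℤ.< k → a ∈ ⟨ X ⟩ → k ·ᶻ (-ᶻ a) ∈ ⟨ X ⟩ → -ᶻ a ∈ ⟨ X ⟩
  neg∈ {k} {i , j} 0<k a∈ ka∈ = subst (_∈ ⟨ X ⟩) (cong₂ _,_ (eq k i) (eq k j))
    (add (scale∈ (ℤ.i≤j⇒0≤j-i (ℤ.i<j⇒suc[i]≤j 0<k)) a∈) ka∈)
    where
    eq : ∀ k i → (k ℤ.- 1ℤ) ℤ.* i ℤ.+ k ℤ.* (ℤ.- i) ≡ ℤ.- i
    eq = solve 2 (λ k i → (k :- con 1ℤ) :* i :+ k :* (:- i) := :- i) refl

  isGroup : (∀ {a} → a ∈ X → -ᶻ a ∈ ⟨ X ⟩) → MonoidIsGroup (𝒜 X)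
  isGroup neg = (λ (a , a∈) → -ᶻ a , neg-closed a∈) , record
    { isMonoid = Monoid.isMonoid (𝒜 X)
    ; inverse  = (λ ((i , j) , _) → cong₂ _,_ (ℤ.+-inverseˡ i) (ℤ.+-inverseˡ j))
               , (λ ((i , j) , _) → cong₂ _,_ (ℤ.+-inverseʳ i) (ℤ.+-inverseʳ j))
    ; ⁻¹-cong  = cong -ᶻ_
    }
    where
    neg-closed : ∀ {a} → a ∈ ⟨ X ⟩ → -ᶻ a ∈ ⟨ X ⟩
    neg-closed (gen a∈) = neg a∈
    neg-closed zero     = zero
    neg-closed (add {i , j} {k , l} a∈ b∈) = subst (_∈ ⟨ X ⟩)
      (sym (cong₂ _,_ (ℤ.neg-distrib-+ i k) (ℤ.neg-distrib-+ j l)))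
      (add (neg-closed a∈) (neg-closed b∈))

open +-*-Solver

-- Rational numbers

0≤p+q : ∀ {p q} → 0ℚ ℚ.≤ p → 0ℚ ℚ.≤ q → 0ℚ ℚ.≤ p ℚ.+ q
0≤p+q = ℚ.+-mono-≤

0≤p*q : ∀ {p q} → 0ℚ ℚ.≤ p → 0ℚ ℚ.≤ q → 0ℚ ℚ.≤ p ℚ.* q
0≤p*q {p} {q} 0≤p 0≤q = ℚ.nonNegative⁻¹ (p ℚ.* q)
  {{ℚ.nonNeg*nonNeg⇒nonNeg p {{ℚ.nonNegative 0≤p}} q {{ℚ.nonNegative 0≤q}}}}

p≤q⇒0≤q-p : ∀ {p q} → p ℚ.≤ q → 0ℚ ℚ.≤ q ℚ.- p
p≤q⇒0≤q-p {p} {q} p≤q =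
  subst (ℚ._≤ q ℚ.- p) (ℚ.+-inverseʳ p) (ℚ.+-monoˡ-≤ (ℚ.- p) p≤q)

p-q<r⇒p<q+r : ∀ p q {r} → p ℚ.- q ℚ.< r → p ℚ.< q ℚ.+ r
p-q<r⇒p<q+r p q p-q<r = subst (ℚ._< q ℚ.+ _)
  (solve 2 (λ p q → q :+ (p :- q) := p) refl p q)
  (ℚ.+-monoʳ-< q p-q<r)

p≤∣p∣ : ∀ p → p ℚ.≤ ℚ.∣ p ∣
p≤∣p∣ p with ℚ.≤-total 0ℚ p
... | inj₁ 0≤p = ℚ.≤-reflexive (sym (ℚ.0≤p⇒∣p∣≡p 0≤p))
... | inj₂ p≤0 = ℚ.≤-trans p≤0 (ℚ.0≤∣p∣ p)

∣p-q∣≡∣q-p∣ : ∀ p q → ℚ.∣ p ℚ.- q ∣ ≡ ℚ.∣ q ℚ.- p ∣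
∣p-q∣≡∣q-p∣ p q = trans (sym (ℚ.∣-p∣≡∣p∣ (p ℚ.- q)))
  (cong ℚ.∣_∣ (solve 2 (λ p q → :- (p :- q) := q :- p) refl p q))

∣p+q∣<ε : ∀ {δ ε} p q → δ ℚ.+ δ ≡ ε → ℚ.∣ p ∣ ℚ.< δ → ℚ.∣ q ∣ ℚ.< δ → ℚ.∣ p ℚ.+ q ∣ ℚ.< ε
∣p+q∣<ε p q refl p<δ q<δ = ℚ.≤-<-trans (ℚ.∣p+q∣≤∣p∣+∣q∣ p q) (ℚ.+-mono-< p<δ q<δ)

0<p*q : ∀ {p q} → 0ℚ ℚ.< p → 0ℚ ℚ.< q → 0ℚ ℚ.< p ℚ.* q
0<p*q {p} {q} 0<p 0<q = ℚ.positive⁻¹ (p ℚ.* q)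
  {{ℚ.pos*pos⇒pos p {{ℚ.positive 0<p}} q {{ℚ.positive 0<q}}}}

∣p∣*∣p∣≡p*p : ∀ p → ℚ.∣ p ∣ ℚ.* ℚ.∣ p ∣ ≡ p ℚ.* p
∣p∣*∣p∣≡p*p p with ℚ.∣p∣≡p∨∣p∣≡-p p
... | inj₁ ∣p∣≡p  = cong₂ ℚ._*_ ∣p∣≡p ∣p∣≡p
... | inj₂ ∣p∣≡-p = trans (cong₂ ℚ._*_ ∣p∣≡-p ∣p∣≡-p)
  (solve 1 (λ p → :- p :* :- p := p :* p) refl p)

0≤p² : ∀ p → 0ℚ ℚ.≤ p ℚ.* p
0≤p² p = subst (0ℚ ℚ.≤_) (∣p∣*∣p∣≡p*p p) (0≤p*q (ℚ.0≤∣p∣ p) (ℚ.0≤∣p∣ p))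

p≤p+q : ∀ p {q} → 0ℚ ℚ.≤ q → p ℚ.≤ p ℚ.+ q
p≤p+q p {q} 0≤q = subst (ℚ._≤ p ℚ.+ q) (ℚ.+-identityʳ p) (ℚ.+-monoʳ-≤ p 0≤q)

-- `η` is the gap contained in `_<_` on `ℝ`; the hypothesis is one term of an unfolded bound on
-- `∥_∥²`.
p²+q²<e²⇒∣p∣≤e : ∀ {e} p q {η} → 0ℚ ℚ.≤ e → 0ℚ ℚ.< η →
  p ℚ.* p ℚ.+ q ℚ.* q ℚ.+ η ℚ.< e ℚ.* e → ℚ.∣ p ∣ ℚ.≤ e
p²+q²<e²⇒∣p∣≤e {e} p q {η} 0≤e 0<η p²+q²<e² with ℚ.≤-total ℚ.∣ p ∣ e
... | inj₁ ∣p∣≤e = ∣p∣≤e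
... | inj₂ e≤∣p∣ = ⊥-elim (ℚ.<-irrefl refl (ℚ.<-≤-trans p²+q²<e² (begin
  e ℚ.* e                         ≤⟨ ℚ.*-monoˡ-≤-nonNeg e {{ℚ.nonNegative 0≤e}} e≤∣p∣ ⟩
  e ℚ.* ℚ.∣ p ∣                   ≤⟨ ℚ.*-monoʳ-≤-nonNeg ℚ.∣ p ∣ {{ℚ.∣-∣-nonNeg p}} e≤∣p∣ ⟩
  ℚ.∣ p ∣ ℚ.* ℚ.∣ p ∣             ≡⟨ ∣p∣*∣p∣≡p*p p ⟩
  p ℚ.* p                         ≡⟨ ℚ.+-identityʳ (p ℚ.* p) ⟨
  p ℚ.* p ℚ.+ 0ℚ                  ≤⟨ ℚ.+-monoʳ-≤ (p ℚ.* p) (0≤p² q) ⟩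
  p ℚ.* p ℚ.+ q ℚ.* q             ≡⟨ ℚ.+-identityʳ _ ⟨
  p ℚ.* p ℚ.+ q ℚ.* q ℚ.+ 0ℚ      ≤⟨ ℚ.+-monoʳ-≤ (p ℚ.* p ℚ.+ q ℚ.* q) (ℚ.<⇒≤ 0<η) ⟩
  p ℚ.* p ℚ.+ q ℚ.* q ℚ.+ η       ∎)))
  where open ℚ.≤-Reasoning

linear-bound : ∀ α β p q {e} → ℚ.∣ p ∣ ℚ.≤ e → ℚ.∣ q ∣ ℚ.≤ e →
  ℚ.∣ α ℚ.* p ℚ.+ β ℚ.* q ∣ ℚ.≤ (ℚ.∣ α ∣ ℚ.+ ℚ.∣ β ∣) ℚ.* e
linear-bound α β p q {e} p≤e q≤e = begin
  ℚ.∣ α ℚ.* p ℚ.+ β ℚ.* q ∣                     ≤⟨ ℚ.∣p+q∣≤∣p∣+∣q∣ (α ℚ.* p) (β ℚ.* q) ⟩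
  ℚ.∣ α ℚ.* p ∣ ℚ.+ ℚ.∣ β ℚ.* q ∣               ≡⟨ cong₂ ℚ._+_ (ℚ.∣p*q∣≡∣p∣*∣q∣ α p) (ℚ.∣p*q∣≡∣p∣*∣q∣ β q) ⟩
  ℚ.∣ α ∣ ℚ.* ℚ.∣ p ∣ ℚ.+ ℚ.∣ β ∣ ℚ.* ℚ.∣ q ∣   ≤⟨ ℚ.+-mono-≤ (scale α p≤e) (scale β q≤e) ⟩
  ℚ.∣ α ∣ ℚ.* e ℚ.+ ℚ.∣ β ∣ ℚ.* e               ≡⟨ ℚ.*-distribʳ-+ e ℚ.∣ α ∣ ℚ.∣ β ∣ ⟨
  (ℚ.∣ α ∣ ℚ.+ ℚ.∣ β ∣) ℚ.* e                   ∎
  where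
  open ℚ.≤-Reasoning
  scale : ∀ α {p e} → p ℚ.≤ e → ℚ.∣ α ∣ ℚ.* p ℚ.≤ ℚ.∣ α ∣ ℚ.* e
  scale α = ℚ.*-monoˡ-≤-nonNeg ℚ.∣ α ∣ {{ℚ.nonNegative (ℚ.0≤∣p∣ α)}}

ι : ℤ → ℚ
ι i = i ℚ./ 1

private
  ιᵘ : ℤ → ℚᵘ
  ιᵘ i = mkℚᵘ i 0

  toℚᵘ-ι : ∀ i → ℚ.toℚᵘ (ι i) ℚᵘ.≃ ιᵘ i
  toℚᵘ-ι i = ℚ.toℚᵘ-fromℚᵘ (ιᵘ i)

-- `ι` reduces a fraction to lowest terms and is stuck on a variable. Among unnormalised fractions
-- numerators and denominators are explicit, so the law is checked there and carried back.
ι-+ : ∀ i j → ι (i ℤ.+ j) ≡ ι i ℚ.+ ι j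
ι-+ i j = ℚ.toℚᵘ-injective (begin
  ℚ.toℚᵘ (ι (i ℤ.+ j))             ≈⟨ toℚᵘ-ι (i ℤ.+ j) ⟩
  ιᵘ (i ℤ.+ j)                     ≈⟨ ℚᵘ.*≡* (cong (ℤ._* 1ℤ) (cong₂ ℤ._+_ (ℤ.*-identityʳ i) (ℤ.*-identityʳ j))) ⟨
  ιᵘ i ℚᵘ.+ ιᵘ j                   ≈⟨ ℚᵘ.+-cong (toℚᵘ-ι i) (toℚᵘ-ι j) ⟨
  ℚ.toℚᵘ (ι i) ℚᵘ.+ ℚ.toℚᵘ (ι j)   ≈⟨ ℚ.toℚᵘ-homo-+ (ι i) (ι j) ⟨
  ℚ.toℚᵘ (ι i ℚ.+ ι j)             ∎)
  where open import Relation.Binary.Reasoning.Setoid ℚᵘ.≃-setoid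

ι-* : ∀ i j → ι (i ℤ.* j) ≡ ι i ℚ.* ι j
ι-* i j = ℚ.toℚᵘ-injective (begin
  ℚ.toℚᵘ (ι (i ℤ.* j))             ≈⟨ toℚᵘ-ι (i ℤ.* j) ⟩
  ιᵘ i ℚᵘ.* ιᵘ j                   ≈⟨ ℚᵘ.*-cong (toℚᵘ-ι i) (toℚᵘ-ι j) ⟨
  ℚ.toℚᵘ (ι i) ℚᵘ.* ℚ.toℚᵘ (ι j)   ≈⟨ ℚ.toℚᵘ-homo-* (ι i) (ι j) ⟨
  ℚ.toℚᵘ (ι i ℚ.* ι j)             ∎)
  where open import Relation.Binary.Reasoning.Setoid ℚᵘ.≃-setoid

ι-mono-≤ : ∀ {i j} → i ℤ.≤ j → ι i ℚ.≤ ι j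
ι-mono-≤ {i} {j} i≤j = ℚ.toℚᵘ-cancel-≤
  (ℚᵘ.≤-respʳ-≃ (ℚᵘ.≃-sym (toℚᵘ-ι j)) (ℚᵘ.≤-respˡ-≃ (ℚᵘ.≃-sym (toℚᵘ-ι i))
    (ℚᵘ.*≤* (ℤ.*-monoʳ-≤-nonNeg 1ℤ i≤j))))

ι-mono-< : ∀ {i j} → i ℤ.< j → ι i ℚ.< ι j
ι-mono-< {i} {j} i<j = ℚ.toℚᵘ-cancel-<
  (ℚᵘ.<-respʳ-≃ (ℚᵘ.≃-sym (toℚᵘ-ι j)) (ℚᵘ.<-respˡ-≃ (ℚᵘ.≃-sym (toℚᵘ-ι i))
    (ℚᵘ.*<* (ℤ.*-monoʳ-<-pos 1ℤ i<j))))

-- Real numbers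

Eventually : (ℕ → Set) → Set
Eventually P = ∃[ N ] ∀ n → N ℕ.≤ n → P n

always : ∀ {P} → (∀ n → P n) → Eventually P
always p = 0 , λ n _ → p n

ev-map : ∀ {P Q} → (∀ n → P n → Q n) → Eventually P → Eventually Q
ev-map f (N , p) = N , λ n n≥ → f n (p n n≥)

ev-zip : ∀ {P Q R} → (∀ n → P n → Q n → R n) → Eventually P → Eventually Q → Eventually R
ev-zip f (M , p) (N , q) = M ℕ.⊔ N , λ n n≥ →
  f n (p n (ℕ.m⊔n≤o⇒m≤o M N n≥)) (q n (ℕ.m⊔n≤o⇒n≤o M N n≥))

ev-const : ∀ {A : Set} → Eventually (λ _ → A) → A
ev-const (N , p) = p N ℕ.≤-refl

-- Arithmetic on `ℝ` acts termwise, so this lifts every ring identity from `ℚ`. The endpoints are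
-- spelled out at its uses because a sequence does not determine its Cauchy proof.
pointwise : ∀ {x y} → (∀ n → seq x n ≡ seq y n) → x ≃ y
pointwise {x} {y} x≡y ε 0<ε = always λ n →
  subst (λ z → ℚ.∣ z ∣ ℚ.< ε) (sym (trans (cong (ℚ._- seq y n) (x≡y n)) (ℚ.+-inverseʳ (seq y n)))) 0<ε

≃-refl : ∀ {x} → x ≃ x
≃-refl {x} = pointwise {x} {x} λ _ → refl

≃-sym : ∀ {x y} → x ≃ y → y ≃ x
≃-sym {x} {y} x≃y ε 0<ε = ev-map
  (λ n → subst (ℚ._< ε) (∣p-q∣≡∣q-p∣ (seq x n) (seq y n))) (x≃y ε 0<ε)

≃-trans : ∀ {x y z} → x ≃ y → y ≃ z → x ≃ z
≃-trans {x} {y} {z} x≃y y≃z ε 0<ε =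
  let δ , 0<δ , δ+δ≡ε = halve 0<ε in
  ev-zip
    (λ n p q → subst (λ w → ℚ.∣ w ∣ ℚ.< ε)
      (solve 3 (λ x y z → (x :- y) :+ (y :- z) := x :- z) refl (seq x n) (seq y n) (seq z n))
      (∣p+q∣<ε (seq x n ℚ.- seq y n) (seq y n ℚ.- seq z n) δ+δ≡ε p q))
    (x≃y δ 0<δ) (y≃z δ 0<δ)

≃-setoid : Setoid 0ℓ 0ℓ
≃-setoid = record
  { Carrier       = ℝ
  ; _≈_           = _≃_
  ; isEquivalence = record
    { refl  = λ {x} → ≃-refl {x}
    ; sym   = λ {x y} → ≃-sym {x} {y}
    ; trans = λ {x y z} → ≃-trans {x} {y} {z}
    }
  }

module ≃-Reasoning where
  open import Relation.Binary.Reasoning.Setoid ≃-setoid public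

+-cong : ∀ {x y z w} → x ≃ y → z ≃ w → x + z ≃ y + w
+-cong {x} {y} {z} {w} x≃y z≃w ε 0<ε =
  let δ , 0<δ , δ+δ≡ε = halve 0<ε in
  ev-zip
    (λ n p q → subst (λ v → ℚ.∣ v ∣ ℚ.< ε)
      (solve 4 (λ x y z w → (x :- y) :+ (z :- w) := (x :+ z) :- (y :+ w)) refl
        (seq x n) (seq y n) (seq z n) (seq w n))
      (∣p+q∣<ε (seq x n ℚ.- seq y n) (seq z n ℚ.- seq w n) δ+δ≡ε p q))
    (x≃y δ 0<δ) (z≃w δ 0<δ)

*-congˡ : ∀ x {y z} → y ≃ z → x * y ≃ x * z
*-congˡ x {y} {z} y≃z ε 0<ε =
  let b , 0<b , ∣x∣≤b = eventually-bounded (seq x) (cauchy x)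
      δ , 0<δ , bδ≡ε  = scale-down 0<b 0<ε
  in ev-zip
    (λ n p q → subst₂ (λ u v → ℚ.∣ u ∣ ℚ.< v)
      (solve 3 (λ x y z → x :* (y :- z) := x :* y :- x :* z) refl (seq x n) (seq y n) (seq z n))
      bδ≡ε
      (product-bound 0<b (seq x n) (seq y n ℚ.- seq z n) p q))
    ∣x∣≤b (y≃z δ 0<δ)

0≤-resp : ∀ {x y} → x ≃ y → 0ℝ ≤ x → 0ℝ ≤ y
0≤-resp {x} {y} x≃y 0≤x ε 0<ε =
  let δ , 0<δ , δ+δ≡ε = halve 0<ε in
  ev-zip
    (λ n p q → begin-strict
      0ℚ                          <⟨ p ⟩
      seq x n ℚ.+ δ               <⟨ ℚ.+-monoˡ-< δ (p-q<r⇒p<q+r (seq x n) (seq y n) (ℚ.≤-<-trans (p≤∣p∣ _) q)) ⟩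
      seq y n ℚ.+ δ ℚ.+ δ         ≡⟨ ℚ.+-assoc (seq y n) δ δ ⟩
      seq y n ℚ.+ (δ ℚ.+ δ)       ≡⟨ cong (seq y n ℚ.+_) δ+δ≡ε ⟩
      seq y n ℚ.+ ε               ∎)
    (0≤x δ 0<δ) (x≃y δ 0<δ)
  where open ℚ.≤-Reasoning

0≤x+y : ∀ {x y} → 0ℝ ≤ x → 0ℝ ≤ y → 0ℝ ≤ x + y
0≤x+y {x} {y} 0≤x 0≤y ε 0<ε =
  let δ , 0<δ , δ+δ≡ε = halve 0<ε in
  ev-zip
    (λ n p q → subst (0ℚ ℚ.<_)
      (trans
        (solve 3 (λ x y δ → (x :+ δ) :+ (y :+ δ) := x :+ y :+ (δ :+ δ)) refl (seq x n) (seq y n) δ)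
        (cong (seq x n ℚ.+ seq y n ℚ.+_) δ+δ≡ε))
      (ℚ.+-mono-< p q))
    (0≤x δ 0<δ) (0≤y δ 0<δ)

0≤x*q : ∀ {x q} → 0ℝ ≤ x → 0ℚ ℚ.≤ q → 0ℝ ≤ x * fromℚ q
0≤x*q {x} {q} 0≤x 0≤q ε 0<ε =
  -- Dividing `ε` by `q + 1` rather than `q` covers `q ≡ 0` and leaves one spare `δ` to make the
  -- inequality strict.
  let 0<q+1 = ℚ.+-mono-≤-< 0≤q (ℚ.positive⁻¹ 1ℚ)
      δ , 0<δ , eq = scale-down 0<q+1 0<ε
  in ev-map
    (λ n 0<x+δ → begin-strict
      0ℚ                                                <⟨ 0<δ ⟩
      δ                                                 ≡⟨ ℚ.+-identityʳ δ ⟨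
      δ ℚ.+ 0ℚ                                          ≤⟨ ℚ.+-monoʳ-≤ δ (0≤p*q 0≤q (ℚ.<⇒≤ 0<x+δ)) ⟩
      δ ℚ.+ q ℚ.* (seq x n ℚ.+ δ)                       ≡⟨ solve 3 (λ x q δ → δ :+ q :* (x :+ δ) := x :* q :+ (q :+ con 1ℚ) :* δ) refl (seq x n) q δ ⟩
      seq x n ℚ.* q ℚ.+ (q ℚ.+ 1ℚ) ℚ.* δ                ≡⟨ cong (seq x n ℚ.* q ℚ.+_) eq ⟩
      seq x n ℚ.* q ℚ.+ ε                               ∎)
    (0≤x δ 0<δ)
  where open ℚ.≤-Reasoning

eventually-0≤ : ∀ {x} → Eventually (λ n → 0ℚ ℚ.≤ seq x n) → 0ℝ ≤ x
eventually-0≤ ev ε 0<ε = ev-map (λ n 0≤x → ℚ.+-mono-≤-< 0≤x 0<ε) ev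

0≤fromℚ⁻¹ : ∀ {q} → 0ℝ ≤ fromℚ q → 0ℚ ℚ.≤ q
0≤fromℚ⁻¹ {q} 0≤q = ℚ.≮⇒≥ λ q<0 →
  ℚ.<-irrefl (sym (ℚ.+-inverseʳ q)) (ev-const (0≤q (ℚ.- q) (ℚ.neg-antimono-< q<0)))

0≤-antisym : ∀ {x} → 0ℝ ≤ x → 0ℝ ≤ - x → x ≃ 0ℝ
0≤-antisym {x} 0≤x 0≤-x ε 0<ε = ev-zip close (0≤x ε 0<ε) (0≤-x ε 0<ε)
  where
  close : ∀ n → 0ℚ ℚ.< seq x n ℚ.+ ε → 0ℚ ℚ.< ℚ.- seq x n ℚ.+ ε → ℚ.∣ seq x n ℚ.- 0ℚ ∣ ℚ.< ε
  close n p q with ℚ.∣p∣≡p∨∣p∣≡-p (seq x n ℚ.- 0ℚ)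
  ... | inj₁ eq = subst₂ ℚ._<_
    (trans (solve 1 (λ x → x :+ con 0ℚ := x :- con 0ℚ) refl (seq x n)) (sym eq))
    (solve 2 (λ x ε → x :+ (:- x :+ ε) := ε) refl (seq x n) ε)
    (ℚ.+-monoʳ-< (seq x n) q)
  ... | inj₂ eq = subst₂ ℚ._<_
    (trans (solve 1 (λ x → :- x :+ con 0ℚ := :- (x :- con 0ℚ)) refl (seq x n)) (sym eq))
    (solve 2 (λ x ε → :- x :+ (x :+ ε) := ε) refl (seq x n) ε)
    (ℚ.+-monoʳ-< (ℚ.- seq x n) p)

-- Linear functionals with rational coefficients

emb : ℤ² → ℝ²
emb (i , j) = fromℤ i , fromℤ j

Lℚ : ℚ → ℚ → ℤ² → ℚ
Lℚ α β (i , j) = α ℚ.* ι i ℚ.+ β ℚ.* ι j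

L : ℚ → ℚ → ℝ² → ℝ
L α β (x , y) = fromℚ α * x + fromℚ β * y

Lℚ-dot : ∀ f a → Lℚ (ι (proj₁ f)) (ι (proj₂ f)) a ≡ ι (dot f a)
Lℚ-dot (f₁ , f₂) (i , j) = sym (trans (ι-+ (f₁ ℤ.* i) (f₂ ℤ.* j)) (cong₂ ℚ._+_ (ι-* f₁ i) (ι-* f₂ j)))

L-cong : ∀ α β {p q} → p ≃² q → L α β p ≃ L α β q
L-cong α β {x , y} {x′ , y′} (x≃x′ , y≃y′) =
  +-cong {fromℚ α * x} {fromℚ α * x′} {fromℚ β * y} {fromℚ β * y′}
    (*-congˡ (fromℚ α) {x} {x′} x≃x′) (*-congˡ (fromℚ β) {y} {y′} y≃y′)

L-neg : ∀ α β p → L (ℚ.- α) (ℚ.- β) p ≃ - L α β p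
L-neg α β p = pointwise {L (ℚ.- α) (ℚ.- β) p} {(- L α β p)} λ n →
  solve 4 (λ α β x y → :- α :* x :+ :- β :* y := :- (α :* x :+ β :* y)) refl
    α β (seq (proj₁ p) n) (seq (proj₂ p) n)

L-combination : ∀ α β s p t q → L α β (s · p +² t · q) ≃ s * L α β p + t * L α β q
L-combination α β s p t q =
  pointwise {L α β (s · p +² t · q)} {s * L α β p + t * L α β q} λ n →
  solve 8 (λ α β s x y t x′ y′ →
      α :* (s :* x :+ t :* x′) :+ β :* (s :* y :+ t :* y′) :=
      s :* (α :* x :+ β :* y) :+ t :* (α :* x′ :+ β :* y′)) refl
    α β (seq s n) (seq (proj₁ p) n) (seq (proj₂ p) n)
        (seq t n) (seq (proj₁ q) n) (seq (proj₂ q) n)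

-- Asking for lattice points `a` behind the `u i` makes each term a real weight times a rational
-- constant, the kind of product that `0≤x*q` treats.
0≤L-sum : ∀ α β n (w : Fin n → ℝ) (u : Fin n → ℝ²) →
  (∀ i → 0ℝ ≤ w i) → (∀ i → ∃[ a ] 0ℚ ℚ.≤ Lℚ α β a × u i ≃² emb a) →
  0ℝ ≤ L α β (sum +²-rawMonoid (λ i → w i · u i))
0≤L-sum α β ℕ.zero w u 0≤w 0≤u = eventually-0≤ {L α β O} (always λ n →
  ℚ.≤-reflexive (solve 2 (λ α β → con 0ℚ := α :* con 0ℚ :+ β :* con 0ℚ) refl α β))
0≤L-sum α β (ℕ.suc n) w u 0≤w 0≤u =
  0≤-resp {w zero * L α β (u zero) + L α β rest} {L α β (w zero · u zero +² rest)} split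
    (0≤x+y {w zero * L α β (u zero)} {L α β rest} head≥0
      (0≤L-sum α β n (λ i → w (suc i)) (λ i → u (suc i)) (λ i → 0≤w (suc i)) (λ i → 0≤u (suc i))))
  where
  rest : ℝ²
  rest = sum +²-rawMonoid (λ i → w (suc i) · u (suc i))

  split : w zero * L α β (u zero) + L α β rest ≃ L α β (w zero · u zero +² rest)
  split = pointwise {w zero * L α β (u zero) + L α β rest} {L α β (w zero · u zero +² rest)} λ n →
    solve 7 (λ α β s x y x′ y′ →
        s :* (α :* x :+ β :* y) :+ (α :* x′ :+ β :* y′) :=
        α :* (s :* x :+ x′) :+ β :* (s :* y :+ y′)) refl
      α β (seq (w zero) n) (seq (proj₁ (u zero)) n) (seq (proj₂ (u zero)) n)
      (seq (proj₁ rest) n) (seq (proj₂ rest) n)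

  head≥0 : 0ℝ ≤ w zero * L α β (u zero)
  head≥0 = let a , 0≤a , u≃a = 0≤u zero in
    0≤-resp {w zero * L α β (emb a)} {w zero * L α β (u zero)}
      (≃-sym {w zero * L α β (u zero)} {w zero * L α β (emb a)}
        (*-congˡ (w zero) {L α β (u zero)} {L α β (emb a)} (L-cong α β {u zero} {emb a} u≃a)))
      (0≤x*q {w zero} {Lℚ α β a} (0≤w zero) 0≤a)

conv-⊆-halfspace : ∀ α β {X p} → (∀ {a} → a ∈ X → 0ℚ ℚ.≤ Lℚ α β a) →
  p ∈ Conv (inℝ² X) → 0ℝ ≤ L α β p
conv-⊆-halfspace α β {X} {p} 0≤X (n , w , u , 0≤w , _ , u∈ , p≃) =
  0≤-resp {L α β total} {L α β p}
    (≃-sym {L α β p} {L α β total} (L-cong α β {p} {total} p≃))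
    (0≤L-sum α β n w u 0≤w λ i → let a , a∈ , u≃a = u∈ i in a , 0≤X a∈ , u≃a)
  where
  total : ℝ²
  total = sum +²-rawMonoid (λ i → w i · u i)

-- Membership in `Aff` may be tested on any affine set containing the hull, here the kernel itself.
-- The hull lies in that kernel because it lies in the half-planes of the functional and of its
-- negative.
aff-⊆-kernel : ∀ α β {X p} → (∀ {a} → a ∈ X → Lℚ α β a ≡ 0ℚ) →
  p ∈ Aff (Conv (inℝ² X)) → L α β p ≃ 0ℝ
aff-⊆-kernel α β {X} {p} X≡0 p∈ = p∈ (λ q → L α β q ≃ 0ℝ) isAffine (λ {q} → conv⊆ {q})
  where
  isAffine : IsAffine (λ q → L α β q ≃ 0ℝ)
  isAffine = record
    { resp  = λ {q} {q′} q≃q′ q∈ → ≃-trans {L α β q′} {L α β q} {0ℝ}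
        (≃-sym {L α β q} {L α β q′} (L-cong α β {q} {q′} q≃q′)) q∈
    ; lines = λ {q} {q′} q∈ q′∈ t → begin
        L α β ((1ℝ - t) · q +² t · q′)         ≈⟨ L-combination α β (1ℝ - t) q t q′ ⟩
        (1ℝ - t) * L α β q + t * L α β q′      ≈⟨ +-cong {(1ℝ - t) * L α β q} {(1ℝ - t) * 0ℝ} {t * L α β q′} {t * 0ℝ}
                                                    (*-congˡ (1ℝ - t) {L α β q} {0ℝ} q∈)
                                                    (*-congˡ t {L α β q′} {0ℝ} q′∈) ⟩
        (1ℝ - t) * 0ℝ + t * 0ℝ                 ≈⟨ pointwise {(1ℝ - t) * 0ℝ + t * 0ℝ} {0ℝ} (λ n →
                                                    solve 1 (λ t → (con 1ℚ :- t) :* con 0ℚ :+ t :* con 0ℚ := con 0ℚ)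
                                                      refl (seq t n)) ⟩
        0ℝ                                     ∎
    }
    where open ≃-Reasoning

  conv⊆ : ∀ {q} → q ∈ Conv (inℝ² X) → L α β q ≃ 0ℝ
  conv⊆ {q} q∈ = 0≤-antisym {L α β q}
    (conv-⊆-halfspace α β {X} {q} (λ a∈ → ℚ.≤-reflexive (sym (X≡0 a∈))) q∈)
    (0≤-resp {L (ℚ.- α) (ℚ.- β) q} {(- L α β q)} (L-neg α β q)
      (conv-⊆-halfspace (ℚ.- α) (ℚ.- β) {X} {q}
        (λ {a} a∈ → ℚ.≤-reflexive (sym (trans (Lℚ-neg a) (cong ℚ.-_ (X≡0 a∈))))) q∈))
    where
    Lℚ-neg : ∀ a → Lℚ (ℚ.- α) (ℚ.- β) a ≡ ℚ.- Lℚ α β a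
    Lℚ-neg (i , j) = solve 4 (λ α β x y → :- α :* x :+ :- β :* y := :- (α :* x :+ β :* y)) refl
      α β (ι i) (ι j)

-- Convex hulls

-- Nonnegative combinations of points of X with weights adding up to m, so that
-- Comb X 1ℝ is Conv (inℝ² X).
Comb : Pred ℤ² 0ℓ → ℝ → Pred ℝ² 0ℓ
Comb X m p = ∃[ n ] Σ (Fin n → ℝ) λ w → Σ (Fin n → ℝ²) λ u →
  (∀ i → 0ℝ ≤ w i) ×
  sum +-rawMonoid w ≃ m ×
  (∀ i → u i ∈ inℝ² X) ×
  p ≃² sum +²-rawMonoid (λ i → w i · u i)

≃²-refl : ∀ {p} → p ≃² p
≃²-refl {x , y} = ≃-refl {x} , ≃-refl {y}

≃²-sym : ∀ {p q} → p ≃² q → q ≃² p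
≃²-sym {x , y} {x′ , y′} (e , f) = ≃-sym {x} {x′} e , ≃-sym {y} {y′} f

≃²-trans : ∀ {p q r} → p ≃² q → q ≃² r → p ≃² r
≃²-trans {x , y} {x′ , y′} {x″ , y″} (e , f) (e′ , f′) =
  ≃-trans {x} {x′} {x″} e e′ , ≃-trans {y} {y′} {y″} f f′

module _ {X : Pred ℤ² 0ℓ} where

  comb-resp : ∀ {m m′ p p′} → m ≃ m′ → p ≃² p′ → Comb X m p → Comb X m′ p′
  comb-resp {m} {m′} {p} {p′} m≃m′ p≃p′ (n , w , u , 0≤w , Σw≃m , u∈ , p≃) =
    n , w , u , 0≤w , ≃-trans {sum +-rawMonoid w} {m} {m′} Σw≃m m≃m′ , u∈
    , ≃²-trans {p′} {p} {sum +²-rawMonoid (λ i → w i · u i)} (≃²-sym {p} {p′} p≃p′) p≃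

  comb-nil : Comb X 0ℝ O
  comb-nil = 0 , (λ ()) , (λ ()) , (λ ()) , ≃-refl {0ℝ} , (λ ()) , ≃²-refl {O}

  comb-cons : ∀ {a c m p} → a ∈ X → 0ℝ ≤ c → Comb X m p → Comb X (c + m) (c · emb a +² p)
  comb-cons {a} {c} {m} {p} a∈ 0≤c (n , w , u , 0≤w , Σw≃m , u∈ , (e , f)) =
    ℕ.suc n , c ∷ w , emb a ∷ u
    , (λ { zero → 0≤c ; (suc i) → 0≤w i })
    , +-cong {c} {c} {sum +-rawMonoid w} {m} (≃-refl {c}) Σw≃m
    , (λ { zero → a , a∈ , ≃²-refl {emb a} ; (suc i) → u∈ i })
    , +-cong {ca₁} {ca₁} {proj₁ p} {proj₁ total} (≃-refl {ca₁}) e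
    , +-cong {ca₂} {ca₂} {proj₂ p} {proj₂ total} (≃-refl {ca₂}) f
    where
    ca₁ ca₂ : ℝ
    ca₁ = proj₁ (c · emb a)
    ca₂ = proj₂ (c · emb a)
    total : ℝ²
    total = sum +²-rawMonoid (λ i → w i · u i)

  -- `k` counts the generators in the given expression of `a`, with multiplicity, each receiving
  -- weight `c`. Extending an arbitrary combination, instead of building one from nothing, lets the
  -- case `add` be a mere composition.
  comb-⟨⟩ : ∀ {a} → a ∈ ⟨ X ⟩ → ∃[ k ] ∀ {c m p} → 0ℝ ≤ c → Comb X m p →
    Comb X (fromℤ (+ k) * c + m) (c · emb a +² p)
  comb-⟨⟩ (gen {a} a∈) = 1 , λ {c} {m} {p} 0≤c comb →
    comb-resp {c + m} {fromℤ (+ 1) * c + m} {c · emb a +² p} {c · emb a +² p}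
      (pointwise {c + m} {fromℤ (+ 1) * c + m} λ n →
        solve 2 (λ c m → c :+ m := con 1ℚ :* c :+ m) refl (seq c n) (seq m n))
      (≃²-refl {c · emb a +² p})
      (comb-cons {a} {c} {m} {p} a∈ 0≤c comb)
  comb-⟨⟩ zero = 0 , λ {c} {m} {p} _ comb →
    comb-resp {m} {fromℤ (+ 0) * c + m} {p} {c · O +² p}
      (pointwise {m} {fromℤ (+ 0) * c + m} λ n → drop (seq c n) (seq m n))
      ( (pointwise {proj₁ p} {c * 0ℝ + proj₁ p} λ n → drop′ (seq c n) (seq (proj₁ p) n))
      , (pointwise {proj₂ p} {c * 0ℝ + proj₂ p} λ n → drop′ (seq c n) (seq (proj₂ p) n)))
      comb
    where
    drop : ∀ c x → x ≡ 0ℚ ℚ.* c ℚ.+ x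
    drop = solve 2 (λ c x → x := con 0ℚ :* c :+ x) refl
    drop′ : ∀ c x → x ≡ c ℚ.* 0ℚ ℚ.+ x
    drop′ = solve 2 (λ c x → x := c :* con 0ℚ :+ x) refl
  comb-⟨⟩ (add {a} {b} a∈ b∈) =
    let k , comb-a = comb-⟨⟩ a∈
        l , comb-b = comb-⟨⟩ b∈
    in k ℕ.+ l , λ {c} {m} {p} 0≤c comb →
      comb-resp
        {fromℤ (+ k) * c + (fromℤ (+ l) * c + m)} {fromℤ (+ (k ℕ.+ l)) * c + m}
        {c · emb a +² (c · emb b +² p)} {c · emb (a +ᶻ b) +² p}
        (pointwise {fromℤ (+ k) * c + (fromℤ (+ l) * c + m)} {fromℤ (+ (k ℕ.+ l)) * c + m} λ n →
          trans
            (solve 4 (λ k l c m → k :* c :+ (l :* c :+ m) := (k :+ l) :* c :+ m) refl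
              (ι (+ k)) (ι (+ l)) (seq c n) (seq m n))
            (cong (λ z → z ℚ.* seq c n ℚ.+ seq m n) (sym (ι-+ (+ k) (+ l)))))
        ( (pointwise {proj₁ (c · emb a +² (c · emb b +² p))} {proj₁ (c · emb (a +ᶻ b) +² p)} λ n →
            merge (proj₁ a) (proj₁ b) (seq c n) (seq (proj₁ p) n))
        , (pointwise {proj₂ (c · emb a +² (c · emb b +² p))} {proj₂ (c · emb (a +ᶻ b) +² p)} λ n →
            merge (proj₂ a) (proj₂ b) (seq c n) (seq (proj₂ p) n)))
        (comb-a {c} {fromℤ (+ l) * c + m} {c · emb b +² p} 0≤c (comb-b {c} {m} {p} 0≤c comb))
    where
    merge : ∀ i j c x → c ℚ.* ι i ℚ.+ (c ℚ.* ι j ℚ.+ x) ≡ c ℚ.* ι (i ℤ.+ j) ℚ.+ x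
    merge i j c x = trans
      (solve 4 (λ i j c x → c :* i :+ (c :* j :+ x) := c :* (i :+ j) :+ x) refl (ι i) (ι j) c x)
      (cong (λ z → c ℚ.* z ℚ.+ x) (sym (ι-+ i j)))

  emb∈Conv : ∀ {a} → a ∈ X → emb a ∈ Conv (inℝ² X)
  emb∈Conv {a} a∈ = comb-resp {1ℝ + 0ℝ} {1ℝ} {1ℝ · emb a +² O} {emb a}
    (pointwise {1ℝ + 0ℝ} {1ℝ} λ n → refl)
    ( (pointwise {proj₁ (1ℝ · emb a +² O)} {proj₁ (emb a)} λ n → unit (ι (proj₁ a)))
    , (pointwise {proj₂ (1ℝ · emb a +² O)} {proj₂ (emb a)} λ n → unit (ι (proj₂ a))))
    (comb-cons {a} {1ℝ} {0ℝ} {O} a∈ (eventually-0≤ {1ℝ} (always λ _ → ℚ.<⇒≤ (ℚ.positive⁻¹ 1ℚ))) comb-nil)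
    where
    unit : ∀ x → 1ℚ ℚ.* x ℚ.+ 0ℚ ≡ x
    unit = solve 1 (λ x → con 1ℚ :* x :+ con 0ℚ := x) refl

-- The relative interior of the hull

module _ {X : Pred ℤ² 0ℓ} where

  private
    U : Pred ℝ² 0ℓ
    U = Conv (inℝ² X)

  -- A real relation among integer vectors yields an integer one, because
  -- otherwise a functional from Farkas' lemma contradicts it.
  neg-multiple∈Conv⇒neg∈ : ∀ {a t p} → a ∈ X → 0ℚ ℚ.< t →
    p ≃² fromℚ (ℚ.- t) · emb a → p ∈ U → -ᶻ a ∈ ⟨ X ⟩
  neg-multiple∈Conv⇒neg∈ {a} {t} {p} a∈ 0<t p≃-ta (n , w , u , 0≤w , _ , u∈ , p≃total)
    -- Only the finitely many points occurring in the combination are passed on, so `X` may be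
    -- infinite.
    with farkas n (λ i → proj₁ (u∈ i)) (λ i → gen (proj₁ (proj₂ (u∈ i)))) (-ᶻ a)
  ... | inj₁ (k , 0<k , k∈) = neg∈ 0<k (gen a∈) k∈
  ... | inj₂ (f , f≥0 , f-a<0) = ⊥-elim (ℚ.<-irrefl (sym (ℚ.+-inverseʳ (t ℚ.* Λ)))
      (ℚ.+-mono-<-≤ (0<p*q 0<t 0<Λ) (0≤fromℚ⁻¹ 0≤-tΛ)))
    where
    α β Λ : ℚ
    α = ι (proj₁ f)
    β = ι (proj₂ f)
    Λ = Lℚ α β a

    total : ℝ²
    total = sum +²-rawMonoid (λ i → w i · u i)

    0<Λ : 0ℚ ℚ.< Λ
    0<Λ = subst (0ℚ ℚ.<_) (sym (Lℚ-dot f a)) (ι-mono-< {0ℤ} {dot f a}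
      (ℤ.neg-cancel-< {dot f a} {0ℤ} (subst (ℤ._< 0ℤ) (dot-neg f a) f-a<0)))

    -- The functional is nonnegative on the combination, yet its value at that point is the rational
    -- constant `- (t Λ)`. The contradiction with `0<Λ` thus takes place in `ℚ`.
    0≤-tΛ : 0ℝ ≤ fromℚ (ℚ.- (t ℚ.* Λ))
    0≤-tΛ = 0≤-resp {L α β total} {fromℚ (ℚ.- (t ℚ.* Λ))}
      (begin
        L α β total                       ≈⟨ L-cong α β {total} {p} (≃²-sym {p} {total} p≃total) ⟩
        L α β p                           ≈⟨ L-cong α β {p} {fromℚ (ℚ.- t) · emb a} p≃-ta ⟩
        L α β (fromℚ (ℚ.- t) · emb a)     ≈⟨ pointwise {L α β (fromℚ (ℚ.- t) · emb a)} {fromℚ (ℚ.- (t ℚ.* Λ))} (λ _ →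
                                               solve 5 (λ α β t i j →
                                                   α :* (:- t :* i) :+ β :* (:- t :* j) := :- (t :* (α :* i :+ β :* j)))
                                                 refl α β t (ι (proj₁ a)) (ι (proj₂ a))) ⟩
        fromℚ (ℚ.- (t ℚ.* Λ))             ∎)
      (0≤L-sum α β n w u 0≤w λ i → let y , _ , u≃y = u∈ i in
        y , subst (0ℚ ℚ.≤_) (sym (Lℚ-dot f y)) (ι-mono-≤ (f≥0 i)) , u≃y)
      where open ≃-Reasoning

  -- The line through `O` and `emb a` stays in the affine hull, so its point at the small negative
  -- parameter `- t` falls into the ball. `q` is written in the shape of `IsAffine.lines` for this
  -- reason.
  relint⇒neg∈ : O ∈ RelInt U → ∀ {a} → a ∈ X → -ᶻ a ∈ ⟨ X ⟩
  relint⇒neg∈ (O∈Aff , ε , (η , 0<η , η<ε) , ball) {a} a∈ =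
    let t , 0<t , St≡η = scale-down 0<S 0<η
        q = (1ℝ - fromℚ (ℚ.- t)) · O +² fromℚ (ℚ.- t) · emb a
    in neg-multiple∈Conv⇒neg∈ {a} {t} {q} a∈ 0<t
         ( (pointwise {proj₁ q} {fromℚ (ℚ.- t) * fromℤ (proj₁ a)} λ _ → drop t i)
         , (pointwise {proj₂ q} {fromℚ (ℚ.- t) * fromℤ (proj₂ a)} λ _ → drop t j))
         (ball q
           (λ V affine U⊆V → IsAffine.lines affine {O} {emb a}
             (O∈Aff V affine U⊆V) (U⊆V (emb∈Conv a∈)) (fromℚ (ℚ.- t)))
           (t ℚ.* t , 0<p*q 0<t 0<t , ev-map (λ n → small t 0<t St≡η (seq ε n)) η<ε))
    where
    i j T S : ℚ
    i = ι (proj₁ a)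
    j = ι (proj₂ a)
    T = i ℚ.* i ℚ.+ j ℚ.* j
    S = 1ℚ ℚ.+ T

    0≤T : 0ℚ ℚ.≤ T
    0≤T = 0≤p+q (0≤p² i) (0≤p² j)

    0<S : 0ℚ ℚ.< S
    0<S = ℚ.+-mono-<-≤ (ℚ.positive⁻¹ 1ℚ) 0≤T

    drop : ∀ t x → (1ℚ ℚ.- (ℚ.- t)) ℚ.* 0ℚ ℚ.+ (ℚ.- t) ℚ.* x ≡ (ℚ.- t) ℚ.* x
    drop = solve 2 (λ t x → (con 1ℚ :- (:- t)) :* con 0ℚ :+ :- t :* x := :- t :* x) refl

    -- With `S` equal to 1 plus the squared length of `a`, the squared length of `- t a` plus the
    -- gap `t²` is exactly `t² S`. As `S` is at least 1, this is at most `(S t)²`, that is `η²`; no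
    -- square root is taken.
    small : ∀ t → 0ℚ ℚ.< t → S ℚ.* t ≡ η → ∀ e → 0ℚ ℚ.+ η ℚ.< e →
      let x = (1ℚ ℚ.- (ℚ.- t)) ℚ.* 0ℚ ℚ.+ (ℚ.- t) ℚ.* i ℚ.- 0ℚ
          y = (1ℚ ℚ.- (ℚ.- t)) ℚ.* 0ℚ ℚ.+ (ℚ.- t) ℚ.* j ℚ.- 0ℚ
      in x ℚ.* x ℚ.+ y ℚ.* y ℚ.+ t ℚ.* t ℚ.< e ℚ.* e
    small t 0<t St≡η e 0+η<e = begin-strict
      _                          ≡⟨ solve 3 (λ t i j →
                                      let x = (con 1ℚ :- (:- t)) :* con 0ℚ :+ :- t :* i :- con 0ℚ
                                          y = (con 1ℚ :- (:- t)) :* con 0ℚ :+ :- t :* j :- con 0ℚ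
                                      in x :* x :+ y :* y :+ t :* t :=
                                         t :* t :* (con 1ℚ :+ (i :* i :+ j :* j)))
                                      refl t i j ⟩
      t ℚ.* t ℚ.* S              ≤⟨ p≤p+q (t ℚ.* t ℚ.* S) (0≤p*q (0≤p*q (0≤p² t) (ℚ.<⇒≤ 0<S)) 0≤T) ⟩
      t ℚ.* t ℚ.* S ℚ.+ t ℚ.* t ℚ.* S ℚ.* T
                                 ≡⟨ solve 2 (λ t T →
                                      let S = con 1ℚ :+ T in
                                      t :* t :* S :+ t :* t :* S :* T := (S :* t) :* (S :* t))
                                      refl t T ⟩
      (S ℚ.* t) ℚ.* (S ℚ.* t)    ≡⟨ cong₂ ℚ._*_ St≡η St≡η ⟩
      η ℚ.* η                    <⟨ ℚ.*-monoʳ-<-pos η {{ℚ.positive 0<η}} η<e ⟩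
      η ℚ.* e                    <⟨ ℚ.*-monoˡ-<-pos e {{ℚ.positive (ℚ.<-trans 0<η η<e)}} η<e ⟩
      e ℚ.* e                    ∎
      where
      open ℚ.≤-Reasoning
      η<e : η ℚ.< e
      η<e = subst (ℚ._< e) (ℚ.+-identityˡ η) 0+η<e

  -- Since a + u + v = O, adding the same weight c to a (as a sum of k generators),
  -- u and v does not change s u + t v; c is chosen so that all weights add up to 1.
  combination∈Conv : ∀ {a u v} → a ∈ ⟨ X ⟩ → u ∈ X → v ∈ X → a +ᶻ (u +ᶻ v) ≡ Oᶻ →
    ∃[ r ] 0ℚ ℚ.< r × (∀ s t →
      Eventually (λ n → ℚ.∣ seq s n ∣ ℚ.≤ r) → Eventually (λ n → ℚ.∣ seq t n ∣ ℚ.≤ r) →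
      s · emb u +² t · emb v ∈ U)
  combination∈Conv {a} {u} {v} a∈ u∈ v∈ a+u+v≡O =
    r , 0<r , λ s t s≤r t≤r →
      let c = fromℚ r * (1ℝ - s - t) in
      comb-resp {X}
        {(c + s) + ((c + t) + (fromℤ (+ k) * c + 0ℝ))} {1ℝ}
        {(c + s) · emb u +² ((c + t) · emb v +² (c · emb a +² O))} {s · emb u +² t · emb v}
        (pointwise {(c + s) + ((c + t) + (fromℤ (+ k) * c + 0ℝ))} {1ℝ} λ n →
          mass (seq s n) (seq t n))
        ( (pointwise {proj₁ ((c + s) · emb u +² ((c + t) · emb v +² (c · emb a +² O)))} {proj₁ (s · emb u +² t · emb v)} λ n →
            point (proj₁ a) (proj₁ u) (proj₁ v) (cong proj₁ a+u+v≡O) (seq c n) (seq s n) (seq t n))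
        , (pointwise {proj₂ ((c + s) · emb u +² ((c + t) · emb v +² (c · emb a +² O)))} {proj₂ (s · emb u +² t · emb v)} λ n →
            point (proj₂ a) (proj₂ u) (proj₂ v) (cong proj₂ a+u+v≡O) (seq c n) (seq s n) (seq t n)))
        (comb-cons {X} {u} {c + s} {(c + t) + (fromℤ (+ k) * c + 0ℝ)} {(c + t) · emb v +² (c · emb a +² O)} u∈
          (eventually-0≤ {c + s} (ev-zip (λ n → 0≤c+s (seq s n) (seq t n)) s≤r t≤r))
          (comb-cons {X} {v} {c + t} {fromℤ (+ k) * c + 0ℝ} {c · emb a +² O} v∈
            (eventually-0≤ {c + t} (ev-zip (λ n → 0≤c+t (seq s n) (seq t n)) s≤r t≤r))
            (comb-a {c} {0ℝ} {O}
              (eventually-0≤ {c} (ev-zip (λ n → 0≤c (seq s n) (seq t n)) s≤r t≤r))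
              comb-nil)))
    where
    k : ℕ
    k = proj₁ (comb-⟨⟩ a∈)

    comb-a : ∀ {c m p} → 0ℝ ≤ c → Comb X m p → Comb X (fromℤ (+ k) * c + m) (c · emb a +² p)
    comb-a {c} {m} {p} = proj₂ (comb-⟨⟩ a∈) {c} {m} {p}

    K : ℚ
    K = ι (+ k)

    0≤K : 0ℚ ℚ.≤ K
    0≤K = ι-mono-≤ {0ℤ} {+ k} (+≤+ z≤n)

    inverse : ∃[ r ] 0ℚ ℚ.< r × (1ℚ ℚ.+ 1ℚ ℚ.+ K) ℚ.* r ≡ 1ℚ
    inverse = scale-down (ℚ.+-mono-<-≤ (ℚ.positive⁻¹ (1ℚ ℚ.+ 1ℚ)) 0≤K) (ℚ.positive⁻¹ 1ℚ)

    r : ℚ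
    r = proj₁ inverse

    0<r : 0ℚ ℚ.< r
    0<r = proj₁ (proj₂ inverse)

    0≤r : 0ℚ ℚ.≤ r
    0≤r = ℚ.<⇒≤ 0<r

    Kr≡1 : (1ℚ ℚ.+ 1ℚ ℚ.+ K) ℚ.* r ≡ 1ℚ
    Kr≡1 = proj₂ (proj₂ inverse)

    0≤1-r : 0ℚ ℚ.≤ 1ℚ ℚ.- r
    0≤1-r = subst (0ℚ ℚ.≤_)
      (trans
        (solve 2 (λ K r → (con 1ℚ :+ K) :* r := (con 1ℚ :+ con 1ℚ :+ K) :* r :- r) refl K r)
        (cong (ℚ._- r) Kr≡1))
      (0≤p*q (0≤p+q (ℚ.<⇒≤ (ℚ.positive⁻¹ 1ℚ)) 0≤K) 0≤r)

    0≤r-s : ∀ s → ℚ.∣ s ∣ ℚ.≤ r → 0ℚ ℚ.≤ r ℚ.- s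
    0≤r-s s s≤r = p≤q⇒0≤q-p (ℚ.≤-trans (p≤∣p∣ s) s≤r)

    0≤s+r : ∀ s → ℚ.∣ s ∣ ℚ.≤ r → 0ℚ ℚ.≤ s ℚ.+ r
    0≤s+r s s≤r = subst (0ℚ ℚ.≤_) (solve 2 (λ r s → r :- :- s := s :+ r) refl r s)
      (0≤r-s (ℚ.- s) (subst (ℚ._≤ r) (sym (ℚ.∣-p∣≡∣p∣ s)) s≤r))

    -- Writing 1 as `(k + 2) r` splits `1 - s - t` into `(r - s) + (r - t) + k r`.
    0≤c : ∀ s t → ℚ.∣ s ∣ ℚ.≤ r → ℚ.∣ t ∣ ℚ.≤ r → 0ℚ ℚ.≤ r ℚ.* (1ℚ ℚ.- s ℚ.- t)
    0≤c s t s≤r t≤r = 0≤p*q 0≤r (subst (0ℚ ℚ.≤_)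
      (trans
        (solve 4 (λ K r s t →
            (r :- s) :+ (r :- t) :+ K :* r := (con 1ℚ :+ con 1ℚ :+ K) :* r :- s :- t)
          refl K r s t)
        (cong (λ z → z ℚ.- s ℚ.- t) Kr≡1))
      (0≤p+q (0≤p+q (0≤r-s s s≤r) (0≤r-s t t≤r)) (0≤p*q 0≤K 0≤r)))

    -- The decomposition used vanishes at `s = - r`, `t = r`, so `r` is the largest bound this
    -- choice of `c` allows.
    0≤c+s : ∀ s t → ℚ.∣ s ∣ ℚ.≤ r → ℚ.∣ t ∣ ℚ.≤ r → 0ℚ ℚ.≤ r ℚ.* (1ℚ ℚ.- s ℚ.- t) ℚ.+ s
    0≤c+s s t s≤r t≤r = subst (0ℚ ℚ.≤_)
      (solve 3 (λ r s t →
          (con 1ℚ :- r) :* (s :+ r) :+ r :* (r :- t) := r :* (con 1ℚ :- s :- t) :+ s)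
        refl r s t)
      (0≤p+q (0≤p*q 0≤1-r (0≤s+r s s≤r)) (0≤p*q 0≤r (0≤r-s t t≤r)))

    0≤c+t : ∀ s t → ℚ.∣ s ∣ ℚ.≤ r → ℚ.∣ t ∣ ℚ.≤ r → 0ℚ ℚ.≤ r ℚ.* (1ℚ ℚ.- s ℚ.- t) ℚ.+ t
    0≤c+t s t s≤r t≤r = subst (0ℚ ℚ.≤_)
      (solve 3 (λ r s t → r :* (con 1ℚ :- t :- s) :+ t := r :* (con 1ℚ :- s :- t) :+ t) refl r s t)
      (0≤c+s t s t≤r s≤r)

    mass : ∀ s t → let c = r ℚ.* (1ℚ ℚ.- s ℚ.- t) in
      (c ℚ.+ s) ℚ.+ ((c ℚ.+ t) ℚ.+ (K ℚ.* c ℚ.+ 0ℚ)) ≡ 1ℚ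
    mass s t = trans
      (solve 4 (λ K r s t → let c = r :* (con 1ℚ :- s :- t) in
          (c :+ s) :+ ((c :+ t) :+ (K :* c :+ con 0ℚ)) :=
          (con 1ℚ :+ con 1ℚ :+ K) :* r :* (con 1ℚ :- s :- t) :+ (s :+ t))
        refl K r s t)
      (trans
        (cong (λ z → z ℚ.* (1ℚ ℚ.- s ℚ.- t) ℚ.+ (s ℚ.+ t)) Kr≡1)
        (solve 2 (λ s t → con 1ℚ :* (con 1ℚ :- s :- t) :+ (s :+ t) := con 1ℚ) refl s t))

    point : ∀ a u v → a ℤ.+ (u ℤ.+ v) ≡ 0ℤ → ∀ c s t →
      (c ℚ.+ s) ℚ.* ι u ℚ.+ ((c ℚ.+ t) ℚ.* ι v ℚ.+ (c ℚ.* ι a ℚ.+ 0ℚ)) ≡ s ℚ.* ι u ℚ.+ t ℚ.* ι v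
    point a u v a+u+v≡0 c s t = trans
      (solve 6 (λ c s t a u v →
          (c :+ s) :* u :+ ((c :+ t) :* v :+ (c :* a :+ con 0ℚ)) :=
          c :* (a :+ (u :+ v)) :+ (s :* u :+ t :* v))
        refl c s t (ι a) (ι u) (ι v))
      (trans
        (cong (λ z → c ℚ.* z ℚ.+ (s ℚ.* ι u ℚ.+ t ℚ.* ι v))
          (trans (cong (ι a ℚ.+_) (sym (ι-+ u v))) (trans (sym (ι-+ a (u ℤ.+ v))) (cong ι a+u+v≡0))))
        (solve 2 (λ c x → c :* con 0ℚ :+ x := x) refl c (s ℚ.* ι u ℚ.+ t ℚ.* ι v)))

  -- Rational coordinates on the span of X with respect to u and v.
  Frame : Set₁
  Frame = ∃[ u ] ∃[ v ] u ∈ X × v ∈ X × ∃[ α ] ∃[ β ] ∃[ γ ] ∃[ δ ]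
    (∀ {p} → p ∈ Aff U → p ≃² L α β p · emb u +² L γ δ p · emb v)

  frame : ExcludedMiddle 0ℓ → Oᶻ ∉ X → Satisfiable X → Frame
  -- The functional is the determinant with `u`; its vanishing on all of `X` means that `X` spans
  -- only a line.
  frame em O∉X (u , u∈) with em {∃[ v ] v ∈ X × Lℚ (ℚ.- ι (proj₂ u)) (ι (proj₁ u)) v ≢ 0ℚ}
  ... | yes (v , v∈ , D≢0) =
    u , v , u∈ , v∈ , v₂ ℚ.* r , ℚ.- v₁ ℚ.* r , ℚ.- u₂ ℚ.* r , u₁ ℚ.* r , λ {p} _ →
      ( (pointwise {proj₁ p} {proj₁ (L (v₂ ℚ.* r) (ℚ.- v₁ ℚ.* r) p · emb u +² L (ℚ.- u₂ ℚ.* r) (u₁ ℚ.* r) p · emb v)}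
          λ n → cramer₁ (seq (proj₁ p) n) (seq (proj₂ p) n))
      , (pointwise {proj₂ p} {proj₂ (L (v₂ ℚ.* r) (ℚ.- v₁ ℚ.* r) p · emb u +² L (ℚ.- u₂ ℚ.* r) (u₁ ℚ.* r) p · emb v)}
          λ n → cramer₂ (seq (proj₁ p) n) (seq (proj₂ p) n)))
    where
    u₁ u₂ v₁ v₂ D r : ℚ
    u₁ = ι (proj₁ u)
    u₂ = ι (proj₂ u)
    v₁ = ι (proj₁ v)
    v₂ = ι (proj₂ v)
    D  = ℚ.- u₂ ℚ.* v₁ ℚ.+ u₁ ℚ.* v₂
    r  = (ℚ.1/ D) {{ℚ.≢-nonZero D≢0}}

    rD≡1 : r ℚ.* D ≡ 1ℚ
    rD≡1 = ℚ.*-inverseˡ D {{ℚ.≢-nonZero D≢0}}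

    cramer₁ : ∀ x y → x ≡
      ((v₂ ℚ.* r) ℚ.* x ℚ.+ (ℚ.- v₁ ℚ.* r) ℚ.* y) ℚ.* u₁ ℚ.+ ((ℚ.- u₂ ℚ.* r) ℚ.* x ℚ.+ (u₁ ℚ.* r) ℚ.* y) ℚ.* v₁
    cramer₁ x y = trans (sym (ℚ.*-identityˡ x)) (trans (cong (ℚ._* x) (sym rD≡1))
      (solve 7 (λ u₁ u₂ v₁ v₂ r x y →
          r :* (:- u₂ :* v₁ :+ u₁ :* v₂) :* x :=
          ((v₂ :* r) :* x :+ (:- v₁ :* r) :* y) :* u₁ :+ ((:- u₂ :* r) :* x :+ (u₁ :* r) :* y) :* v₁)
        refl u₁ u₂ v₁ v₂ r x y))

    cramer₂ : ∀ x y → y ≡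
      ((v₂ ℚ.* r) ℚ.* x ℚ.+ (ℚ.- v₁ ℚ.* r) ℚ.* y) ℚ.* u₂ ℚ.+ ((ℚ.- u₂ ℚ.* r) ℚ.* x ℚ.+ (u₁ ℚ.* r) ℚ.* y) ℚ.* v₂
    cramer₂ x y = trans (sym (ℚ.*-identityˡ y)) (trans (cong (ℚ._* y) (sym rD≡1))
      (solve 7 (λ u₁ u₂ v₁ v₂ r x y →
          r :* (:- u₂ :* v₁ :+ u₁ :* v₂) :* y :=
          ((v₂ :* r) :* x :+ (:- v₁ :* r) :* y) :* u₂ :+ ((:- u₂ :* r) :* x :+ (u₁ :* r) :* y) :* v₂)
        refl u₁ u₂ v₁ v₂ r x y))
  ... | no none =
    -- On a line `v` is `u` again with coordinate zero, so both dimensions share one frame. The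
    -- first coordinate is that of the orthogonal projection to `u`; the error is a multiple of the
    -- determinant with `u`, which is zero on the affine hull.
    u , u , u∈ , u∈ , u₁ ℚ.* r , u₂ ℚ.* r , 0ℚ , 0ℚ , λ {p} p∈ →
      let D≃0 = aff-⊆-kernel (ℚ.- u₂) u₁ {X} {p} (λ {a} → D≡0 {a}) p∈ in
      ( perturb {proj₁ p} {proj₁ (L (u₁ ℚ.* r) (u₂ ℚ.* r) p · emb u +² L 0ℚ 0ℚ p · emb u)}
          (ℚ.- (r ℚ.* u₂)) {L (ℚ.- u₂) u₁ p} D≃0 (λ n → project₁ (seq (proj₁ p) n) (seq (proj₂ p) n))
      , perturb {proj₂ p} {proj₂ (L (u₁ ℚ.* r) (u₂ ℚ.* r) p · emb u +² L 0ℚ 0ℚ p · emb u)}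
          (r ℚ.* u₁) {L (ℚ.- u₂) u₁ p} D≃0 (λ n → project₂ (seq (proj₁ p) n) (seq (proj₂ p) n)))
    where
    u₁ u₂ N : ℚ
    u₁ = ι (proj₁ u)
    u₂ = ι (proj₂ u)
    N  = u₁ ℚ.* u₁ ℚ.+ u₂ ℚ.* u₂

    D≡0 : ∀ {a} → a ∈ X → Lℚ (ℚ.- u₂) u₁ a ≡ 0ℚ
    D≡0 {a} a∈ = decidable-stable (Lℚ (ℚ.- u₂) u₁ a ℚ.≟ 0ℚ) λ D≢0 → none (a , a∈ , D≢0)

    0<N : 0ℚ ℚ.< N
    0<N = subst (0ℚ ℚ.<_) (sym (Lℚ-dot u u)) (ι-mono-< (0<dot {u} λ u≡O → O∉X (subst (_∈ X) u≡O u∈)))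

    inverse : ∃[ r ] 0ℚ ℚ.< r × N ℚ.* r ≡ 1ℚ
    inverse = scale-down 0<N (ℚ.positive⁻¹ 1ℚ)

    r : ℚ
    r = proj₁ inverse

    Nr≡1 : N ℚ.* r ≡ 1ℚ
    Nr≡1 = proj₂ (proj₂ inverse)

    perturb : ∀ {x z} e {d} → d ≃ 0ℝ → (∀ n → seq x n ≡ seq z n ℚ.+ e ℚ.* seq d n) → x ≃ z
    perturb {x} {z} e {d} d≃0 x≡ = begin
      x                      ≈⟨ pointwise {x} {z + fromℚ e * d} x≡ ⟩
      z + fromℚ e * d        ≈⟨ +-cong {z} {z} {fromℚ e * d} {fromℚ e * 0ℝ} (≃-refl {z}) (*-congˡ (fromℚ e) {d} {0ℝ} d≃0) ⟩
      z + fromℚ e * 0ℝ       ≈⟨ pointwise {z + fromℚ e * 0ℝ} {z} (λ n →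
                                  solve 2 (λ z e → z :+ e :* con 0ℚ := z) refl (seq z n) e) ⟩
      z                      ∎
      where open ≃-Reasoning

    project₁ : ∀ x y → x ≡
      ((u₁ ℚ.* r) ℚ.* x ℚ.+ (u₂ ℚ.* r) ℚ.* y) ℚ.* u₁ ℚ.+ (0ℚ ℚ.* x ℚ.+ 0ℚ ℚ.* y) ℚ.* u₁ ℚ.+
      (ℚ.- (r ℚ.* u₂)) ℚ.* (ℚ.- u₂ ℚ.* x ℚ.+ u₁ ℚ.* y)
    project₁ x y = trans (sym (ℚ.*-identityˡ x)) (trans (cong (ℚ._* x) (sym Nr≡1))
      (solve 5 (λ u₁ u₂ r x y →
          (u₁ :* u₁ :+ u₂ :* u₂) :* r :* x :=
          ((u₁ :* r) :* x :+ (u₂ :* r) :* y) :* u₁ :+ (con 0ℚ :* x :+ con 0ℚ :* y) :* u₁ :+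
          (:- (r :* u₂)) :* (:- u₂ :* x :+ u₁ :* y))
        refl u₁ u₂ r x y))

    project₂ : ∀ x y → y ≡
      ((u₁ ℚ.* r) ℚ.* x ℚ.+ (u₂ ℚ.* r) ℚ.* y) ℚ.* u₂ ℚ.+ (0ℚ ℚ.* x ℚ.+ 0ℚ ℚ.* y) ℚ.* u₂ ℚ.+
      (r ℚ.* u₁) ℚ.* (ℚ.- u₂ ℚ.* x ℚ.+ u₁ ℚ.* y)
    project₂ x y = trans (sym (ℚ.*-identityˡ y)) (trans (cong (ℚ._* y) (sym Nr≡1))
      (solve 5 (λ u₁ u₂ r x y →
          (u₁ :* u₁ :+ u₂ :* u₂) :* r :* y :=
          ((u₁ :* r) :* x :+ (u₂ :* r) :* y) :* u₂ :+ (con 0ℚ :* x :+ con 0ℚ :* y) :* u₂ :+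
          (r :* u₁) :* (:- u₂ :* x :+ u₁ :* y))
        refl u₁ u₂ r x y))

  group⇒relint : Frame → MonoidIsGroup (𝒜 X) → O ∈ RelInt U
  group⇒relint (u , v , u∈ , v∈ , α , β , γ , δ , coordinates) (inv , isGroup) =
    (λ V affine U⊆V → U⊆V O∈U) , fromℚ e , (e/2 , 0<e/2 , always λ _ → 0+e/2<e) , ball
    where
    -[u+v] : ∃ ⟨ X ⟩
    -[u+v] = inv (u +ᶻ v , add (gen u∈) (gen v∈))

    combination : ∃[ r ] 0ℚ ℚ.< r × (∀ s t →
      Eventually (λ n → ℚ.∣ seq s n ∣ ℚ.≤ r) → Eventually (λ n → ℚ.∣ seq t n ∣ ℚ.≤ r) →
      s · emb u +² t · emb v ∈ U)
    combination = combination∈Conv (proj₂ -[u+v]) u∈ v∈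
      (proj₁ (IsGroup.inverse isGroup) (u +ᶻ v , add (gen u∈) (gen v∈)))

    r : ℚ
    r = proj₁ combination

    0<r : 0ℚ ℚ.< r
    0<r = proj₁ (proj₂ combination)

    combination∈U : ∀ s t →
      Eventually (λ n → ℚ.∣ seq s n ∣ ℚ.≤ r) → Eventually (λ n → ℚ.∣ seq t n ∣ ℚ.≤ r) →
      s · emb u +² t · emb v ∈ U
    combination∈U = proj₂ (proj₂ combination)

    O∈U : O ∈ U
    O∈U = comb-resp {X} {1ℝ} {1ℝ} {0ℝ · emb u +² 0ℝ · emb v} {O} (≃-refl {1ℝ})
      ( (pointwise {proj₁ (0ℝ · emb u +² 0ℝ · emb v)} {0ℝ} λ _ → null (ι (proj₁ u)) (ι (proj₁ v)))
      , (pointwise {proj₂ (0ℝ · emb u +² 0ℝ · emb v)} {0ℝ} λ _ → null (ι (proj₂ u)) (ι (proj₂ v))))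
      (combination∈U 0ℝ 0ℝ (always λ _ → ℚ.<⇒≤ 0<r) (always λ _ → ℚ.<⇒≤ 0<r))
      where
      null : ∀ x y → 0ℚ ℚ.* x ℚ.+ 0ℚ ℚ.* y ≡ 0ℚ
      null = solve 2 (λ x y → con 0ℚ :* x :+ con 0ℚ :* y := con 0ℚ) refl

    -- `A` and `B` bound the two coordinates in terms of the larger entry of a point. The summand 1
    -- keeps `M` positive, so that `r` can be divided by it.
    A B M : ℚ
    A = ℚ.∣ α ∣ ℚ.+ ℚ.∣ β ∣
    B = ℚ.∣ γ ∣ ℚ.+ ℚ.∣ δ ∣
    M = 1ℚ ℚ.+ (A ℚ.+ B)

    0≤A : 0ℚ ℚ.≤ A
    0≤A = 0≤p+q (ℚ.0≤∣p∣ α) (ℚ.0≤∣p∣ β)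

    0≤B : 0ℚ ℚ.≤ B
    0≤B = 0≤p+q (ℚ.0≤∣p∣ γ) (ℚ.0≤∣p∣ δ)

    radius : ∃[ e ] 0ℚ ℚ.< e × M ℚ.* e ≡ r
    radius = scale-down (ℚ.+-mono-<-≤ (ℚ.positive⁻¹ 1ℚ) (0≤p+q 0≤A 0≤B)) 0<r

    e : ℚ
    e = proj₁ radius

    0<e : 0ℚ ℚ.< e
    0<e = proj₁ (proj₂ radius)

    Me≡r : M ℚ.* e ≡ r
    Me≡r = proj₂ (proj₂ radius)

    e/2 : ℚ
    e/2 = proj₁ (halve 0<e)

    0<e/2 : 0ℚ ℚ.< e/2
    0<e/2 = proj₁ (proj₂ (halve 0<e))

    0+e/2<e : 0ℚ ℚ.+ e/2 ℚ.< e
    0+e/2<e = subst (0ℚ ℚ.+ e/2 ℚ.<_) (proj₂ (proj₂ (halve 0<e))) (ℚ.+-monoˡ-< e/2 0<e/2)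

    Ae≤r : A ℚ.* e ℚ.≤ r
    Ae≤r = subst (A ℚ.* e ℚ.≤_)
      (trans (solve 3 (λ A B e → A :* e :+ (con 1ℚ :+ B) :* e := (con 1ℚ :+ (A :+ B)) :* e) refl A B e) Me≡r)
      (p≤p+q (A ℚ.* e) (0≤p*q (0≤p+q (ℚ.<⇒≤ (ℚ.positive⁻¹ 1ℚ)) 0≤B) (ℚ.<⇒≤ 0<e)))

    Be≤r : B ℚ.* e ℚ.≤ r
    Be≤r = subst (B ℚ.* e ℚ.≤_)
      (trans (solve 3 (λ A B e → B :* e :+ (con 1ℚ :+ A) :* e := (con 1ℚ :+ (A :+ B)) :* e) refl A B e) Me≡r)
      (p≤p+q (B ℚ.* e) (0≤p*q (0≤p+q (ℚ.<⇒≤ (ℚ.positive⁻¹ 1ℚ)) 0≤A) (ℚ.<⇒≤ 0<e)))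

    -- The strict bound on the norm holds for eventually all terms, and each such term bounds both
    -- entries by `e`, hence both coordinates by `r`. Absolute values are taken only in `ℚ`.
    ball : ∀ q → q ∈ Aff U → ∥ q -² O ∥² < fromℚ e * fromℚ e → q ∈ U
    ball q q∈ (η , 0<η , norm<) =
      comb-resp {X} {1ℝ} {1ℝ} {L α β q · emb u +² L γ δ q · emb v} {q} (≃-refl {1ℝ})
        (≃²-sym {q} {L α β q · emb u +² L γ δ q · emb v} (coordinates {q} q∈))
        (combination∈U (L α β q) (L γ δ q)
          (ev-map (λ n norm< → ℚ.≤-trans (linear-bound α β (x n) (y n) (x≤e n norm<) (y≤e n norm<)) Ae≤r) norm<)
          (ev-map (λ n norm< → ℚ.≤-trans (linear-bound γ δ (x n) (y n) (x≤e n norm<) (y≤e n norm<)) Be≤r) norm<))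
      where
      x y : ℕ → ℚ
      x = seq (proj₁ q)
      y = seq (proj₂ q)

      Small : ℕ → Set
      Small n = (x n ℚ.- 0ℚ) ℚ.* (x n ℚ.- 0ℚ) ℚ.+ (y n ℚ.- 0ℚ) ℚ.* (y n ℚ.- 0ℚ) ℚ.+ η ℚ.< e ℚ.* e

      x≤e : ∀ n → Small n → ℚ.∣ x n ∣ ℚ.≤ e
      x≤e n norm< = p²+q²<e²⇒∣p∣≤e (x n) (y n) (ℚ.<⇒≤ 0<e) 0<η (subst (ℚ._< e ℚ.* e)
        (solve 3 (λ x y η → (x :- con 0ℚ) :* (x :- con 0ℚ) :+ (y :- con 0ℚ) :* (y :- con 0ℚ) :+ η :=
            x :* x :+ y :* y :+ η) refl (x n) (y n) η) norm<)

      y≤e : ∀ n → Small n → ℚ.∣ y n ∣ ℚ.≤ e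
      y≤e n norm< = p²+q²<e²⇒∣p∣≤e (y n) (x n) (ℚ.<⇒≤ 0<e) 0<η (subst (ℚ._< e ℚ.* e)
        (solve 3 (λ x y η → (x :- con 0ℚ) :* (x :- con 0ℚ) :+ (y :- con 0ℚ) :* (y :- con 0ℚ) :+ η :=
            y :* y :+ x :* x :+ η) refl (x n) (y n) η) norm<)

theorem2p34 : ExcludedMiddle 0ℓ →
    (X : Pred ℤ² 0ℓ) → Oᶻ ∉ X → Satisfiable X →
    MonoidIsGroup (𝒜 X) ⇔ (O ∈ RelInt (Conv (inℝ² X)))
theorem2p34 em X O∉X X≢∅ = mk⇔
  (group⇒relint (frame em O∉X X≢∅))
  (λ O∈ → isGroup (relint⇒neg∈ O∈))
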